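{- Let $c,N\in\mathbb{R}_{\ge1}$. For all nontrivial $G\in\mathcal{S}_N$ we have $$K_1(G)-k(G)\le N\,\frac{\log_2P^+(|G|)}{P^-(|G|)}.$$ In particular, $$\lim_{P^-(|G|)\to\infty,\;G\in\Omega_c\cap\mathcal{S}_N}|K_1(G)-k(G)|=0,$$ i.e. for every $\varepsilon>0$ there is $P_0$ such that $|K_1(G)-k(G)|<\varepsilon$ for all $G\in\Omega_c\cap\mathcal{S}_N$ with $P^-(|G|)\ge P_0$.
   Context: Groups are finite abelian, written additively; $C_n$ is the cyclic group of order $n$. An indexed multiset $S=\{g_1,\ldots,g_\ell\}$ over a set $X\subseteq G$ is a finite (possibly empty) indexed family of elements of $X$; for $I\subseteq[\ell]$ put $S(I)=\{g_i : i\in I\}$, and submultisets of $S$ are the $S(I)$. Put $\sigma(S)=\sum_{g\in S}g$ (with multiplicity), $\sigma(\emptyset)=0$. $S$ is zero-sum if $\sigma(S)=0$; minimal zero-sum if $\sigma(S)=0$ and $\sigma(S')\ne0$ for every $\emptyset\subsetneq S'\subsetneq S$; zero-sum free if $\sigma(S')\neq0$ for every $\emptyset\subsetneq S'\subseteq S$. An irreducible factorization of $S$ over $G\setminus\{0\}$ is a partition $[\ell]=\bigsqcup_{i=1}^m I_i$ into nonempty sets with each $S(I_i)$ minimal zero-sum; two factorizations are equivalent iff they are the same set of blocks $\{I_1,\ldots,I_m\}$. A unique factorization indexed multiset (UFIM) over $G\setminus\{0\}$ is a zero-sum indexed multiset over $G\setminus\{0\}$ with exactly one irreducible factorization up to equivalence.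 The cross number of $S$ is $k(S)=\sum_{g\in S}\frac1{\mathrm{ord}(g)}$ (with multiplicity; $k(\emptyset)=0$). Put $K_1(G)=\max\{k(S): S\text{ is a UFIM over }G\setminus\{0\}\}$ and $k(G)=\max\{k(S): S\text{ is a zero-sum free indexed multiset over }G\setminus\{0\}\}$. $P^-(M)$ and $P^+(M)$ denote the smallest and largest prime divisors of $M$. $\Omega_c$ is the class of finite abelian groups $G$ with $P^+(|G|)\le c\cdot P^-(|G|)$, and $\mathcal{S}_N$ is the class of finite abelian groups $G=\bigoplus_{i=1}^n\bigoplus_{j=1}^{n_i}C_{p_i^{e_{ij}}}$ (distinct primes $p_i$, $e_{ij}\ge1$) with $\sum_{i=1}^n\sum_{j=1}^{n_i}e_{ij}\le N$. -}

module Defs where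

open import Algebra.Bundles using (AbelianGroup)
import Algebra.Construct.DirectProduct as DirectProduct
import Algebra.Construct.Terminal as Terminal
open import Algebra.Morphism.Structures using (IsGroupIsomorphism)
import Algebra.Properties.CommutativeMonoid.Sum
import Algebra.Properties.CommutativeSemigroup
import Algebra.Properties.Group
import Algebra.Properties.Monoid.Mult
import Data.Bool.Properties as Bool
open import Data.Bool.Base using (true; false; if_then_else_)
open import Data.Fin.Base as Fin using (Fin; zero; suc; toℕ)
import Data.Fin.Properties as Fin
open import Data.Fin.Subset
  using (Subset; inside; outside; ⊤; ⁅_⁆; _∈_; _∉_; _⊆_; _⊂_; _∩_; _─_; ∁; ∣_∣; Nonempty; Empty)
  renaming (⊥ to ∅)
open import Data.Fin.Subset.Induction using (⊂-wellFounded; Acc; acc)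
import Data.Fin.Subset.Properties as Subset
open import Data.Integer.Base as ℤ using (ℤ; +_)
import Data.Integer.Divisibility.Signed as ℤ
import Data.Integer.Properties as ℤ
open import Data.Integer.Solver using () renaming (module +-*-Solver to ℤSolver)
open import Data.List.Base as List using (List; []; _∷_)
import Data.List.Extrema as Extrema
import Data.List.Extrema.Nat as ℕExtrema
import Data.List.Membership.Propositional as List∈
import Data.List.Membership.Propositional.Properties as List∈
open import Data.List.Relation.Unary.All as All using (All; []; _∷_)
import Data.List.Relation.Unary.All.Properties as All
open import Data.List.Relation.Unary.AllPairs using (AllPairs; []; _∷_)
open import Data.List.Relation.Unary.Any using (Any; here; there)
open import Data.List.Relation.Unary.Unique.Propositional using (Unique)
open import Data.Nat.Base as ℕ using (ℕ; zero; suc; NonZero; NonTrivial; z≤n; s≤s)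
open import Data.Nat.Divisibility using (_∣?_)
open import Data.Nat.Logarithm using (⌊log₂_⌋; ⌊log₂⌋-mono-≤; ⌊log₂[2^n]⌋≡n; ⌊log₂⌊n/2⌋⌋≡⌊log₂n⌋∸1)
open import Data.Nat.Primality using (Prime; prime?; prime⇒nonZero)
open import Data.Nat.ListAction using (sum)
import Data.Nat.Properties as ℕ
open import Data.Product using (∃; ∃₂; _×_; _,_; proj₁; proj₂)
open import Data.Rational.Base as ℚ using (ℚ; 0ℚ; 1ℚ)
import Data.Rational.Properties as ℚ
open import Data.Rational.Solver using () renaming (module +-*-Solver to ℚSolver)
import Data.Rational.Unnormalised.Base as ℚᵘ
import Data.Rational.Unnormalised.Properties as ℚᵘ
open import Data.Sum.Base using (inj₁; inj₂)
open import Data.Vec.Base as Vec using (Vec; []; _∷_; lookup; here; there)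
open import Data.Vec.Functional using (Vector)
import Data.Vec.Properties as Vec
open import Function.Base using (_∘_)
open import Function.Bundles using (Inverse; _⇔_; mk⇔; Equivalence)
open import Level using (0ℓ)
open import Relation.Binary.Bundles using (DecTotalOrder)
open import Relation.Binary.Definitions using (tri<; tri≈; tri>)
import Relation.Binary.PropositionalEquality as ≡
open ≡ using (_≡_; refl; sym; trans; cong; cong₂; subst; subst₂)
import Relation.Binary.Reasoning.Setoid
open import Relation.Nullary using (¬_; Dec; does; yes; no; contradiction)
open import Relation.Nullary.Decidable using (map′; ¬?; _×-dec_; _→-dec_; dec-true; decidable-stable)
open import Relation.Unary using (Decidable; Pred)

-- Reals are Cauchy sequences of rationals; instead of taking a quotient, the
-- relations _≤ᴿ_ and _<ᴿ_ are defined so as to respect equality of limits.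
-- Strictness needs a rational gap, and x ≤ᴿ y is the negation of y <ᴿ x.
record ℝ : Set where
  field
    seq    : ℕ → ℚ
    cauchy : ∀ ε → 0ℚ ℚ.< ε →
             ∃ λ M → ∀ m n → M ℕ.≤ m → M ℕ.≤ n → ℚ.∣ seq m ℚ.- seq n ∣ ℚ.< ε

open ℝ

infix  4 _≤ᴿ_ _<ᴿ_
infixl 7 _*ᴿ_

_≤ᴿ_ : ℝ → ℝ → Set
x ≤ᴿ y = ∀ ε → 0ℚ ℚ.< ε → ∃ λ M → ∀ n → M ℕ.≤ n → seq x n ℚ.≤ seq y n ℚ.+ ε

_<ᴿ_ : ℝ → ℝ → Set
x <ᴿ y = ∃ λ ε → 0ℚ ℚ.< ε × ∃ λ M → ∀ n → M ℕ.≤ n → seq x n ℚ.+ ε ℚ.≤ seq y n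

fromℚ : ℚ → ℝ
fromℚ q .seq    _     = q
fromℚ q .cauchy ε 0<ε =
  0 , λ _ _ _ _ → subst (ℚ._< ε) (sym (cong ℚ.∣_∣ (ℚ.+-inverseʳ q))) 0<ε

fromℕ : ℕ → ℝ
fromℕ n = fromℚ (+ n ℚ./ 1)

1ᴿ : ℝ
1ᴿ = fromℚ 1ℚ

0ᴿ : ℝ
0ᴿ = fromℚ 0ℚ

eventuallyBounded : ∀ x → ∃ λ B → 0ℚ ℚ.< B × ∃ λ M → ∀ n → M ℕ.≤ n → ℚ.∣ seq x n ∣ ℚ.≤ B
eventuallyBounded x with cauchy x 1ℚ (ℚ.positive⁻¹ 1ℚ)
... | M , close = ℚ.∣ a ∣ ℚ.+ 1ℚ , ℚ.+-mono-≤-< (ℚ.0≤∣p∣ a) (ℚ.positive⁻¹ 1ℚ) , M , bound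
  where
  a = seq x M
  bound : ∀ n → M ℕ.≤ n → ℚ.∣ seq x n ∣ ℚ.≤ ℚ.∣ a ∣ ℚ.+ 1ℚ
  bound n M≤n = begin
    ℚ.∣ seq x n ∣                         ≡⟨ cong ℚ.∣_∣ (split a (seq x n)) ⟩
    ℚ.∣ a ℚ.+ (seq x n ℚ.- a) ∣           ≤⟨ ℚ.∣p+q∣≤∣p∣+∣q∣ a _ ⟩
    ℚ.∣ a ∣ ℚ.+ ℚ.∣ seq x n ℚ.- a ∣       ≤⟨ ℚ.+-monoʳ-≤ ℚ.∣ a ∣ (ℚ.<⇒≤ (close n M M≤n ℕ.≤-refl)) ⟩
    ℚ.∣ a ∣ ℚ.+ 1ℚ                        ∎
    where
    open ℚ.≤-Reasoning
    open ℚSolver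
    split : ∀ p q → q ≡ p ℚ.+ (q ℚ.- p)
    split = solve 2 (λ p q → q := p :+ (q :- p)) refl

quotient : ∀ ε C → 0ℚ ℚ.< ε → 0ℚ ℚ.< C → ∃ λ δ → 0ℚ ℚ.< δ × δ ℚ.* C ≡ ε
quotient ε C 0<ε 0<C = δ , 0<δ , trans (ℚ.*-assoc ε (ℚ.1/ C) C)
  (trans (cong (ε ℚ.*_) (ℚ.*-inverseˡ C)) (ℚ.*-identityʳ ε))
  where
  instance
    C>0   = ℚ.positive 0<C
    C≢0   = ℚ.pos⇒nonZero C
  δ = ε ℚ.* (ℚ.1/ C)
  0<δ : 0ℚ ℚ.< δ
  0<δ = ℚ.positive⁻¹ δ {{ℚ.pos*pos⇒pos ε {{ℚ.positive 0<ε}} (ℚ.1/ C) {{ℚ.1/pos⇒pos C}}}}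

product-close : ∀ {A B δ} p q r s → 0ℚ ℚ.< A → 0ℚ ℚ.< δ →
                ℚ.∣ p ∣ ℚ.≤ A → ℚ.∣ s ∣ ℚ.≤ B →
                ℚ.∣ p ℚ.- q ∣ ℚ.< δ → ℚ.∣ r ℚ.- s ∣ ℚ.< δ →
                ℚ.∣ p ℚ.* r ℚ.- q ℚ.* s ∣ ℚ.< δ ℚ.* (A ℚ.+ B)
product-close {A} {B} {δ} p q r s 0<A 0<δ ∣p∣≤A ∣s∣≤B ∣p-q∣<δ ∣r-s∣<δ = begin-strict
  ℚ.∣ p ℚ.* r ℚ.- q ℚ.* s ∣                            ≡⟨ cong ℚ.∣_∣ (split p q r s) ⟩
  ℚ.∣ p ℚ.* (r ℚ.- s) ℚ.+ (p ℚ.- q) ℚ.* s ∣            ≤⟨ ℚ.∣p+q∣≤∣p∣+∣q∣ (p ℚ.* (r ℚ.- s)) ((p ℚ.- q) ℚ.* s) ⟩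
  ℚ.∣ p ℚ.* (r ℚ.- s) ∣ ℚ.+ ℚ.∣ (p ℚ.- q) ℚ.* s ∣
    ≡⟨ cong₂ ℚ._+_ (ℚ.∣p*q∣≡∣p∣*∣q∣ p (r ℚ.- s)) (ℚ.∣p*q∣≡∣p∣*∣q∣ (p ℚ.- q) s) ⟩
  ℚ.∣ p ∣ ℚ.* ℚ.∣ r ℚ.- s ∣ ℚ.+ ℚ.∣ p ℚ.- q ∣ ℚ.* ℚ.∣ s ∣ ≤⟨ ℚ.+-mono-≤ first second ⟩
  A ℚ.* ℚ.∣ r ℚ.- s ∣ ℚ.+ δ ℚ.* B                      <⟨ ℚ.+-monoˡ-< (δ ℚ.* B) third ⟩
  A ℚ.* δ ℚ.+ δ ℚ.* B                                  ≡⟨ cong (ℚ._+ δ ℚ.* B) (ℚ.*-comm A δ) ⟩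
  δ ℚ.* A ℚ.+ δ ℚ.* B                                  ≡⟨ ℚ.*-distribˡ-+ δ A B ⟨
  δ ℚ.* (A ℚ.+ B)                                      ∎
  where
  open ℚ.≤-Reasoning
  split : ∀ p q r s → p ℚ.* r ℚ.- q ℚ.* s ≡ p ℚ.* (r ℚ.- s) ℚ.+ (p ℚ.- q) ℚ.* s
  split = solve 4 (λ p q r s → p :* r :- q :* s := p :* (r :- s) :+ (p :- q) :* s) refl
    where open ℚSolver
  first : ℚ.∣ p ∣ ℚ.* ℚ.∣ r ℚ.- s ∣ ℚ.≤ A ℚ.* ℚ.∣ r ℚ.- s ∣
  first = ℚ.*-monoʳ-≤-nonNeg ℚ.∣ r ℚ.- s ∣ {{ℚ.∣-∣-nonNeg (r ℚ.- s)}} ∣p∣≤A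
  second : ℚ.∣ p ℚ.- q ∣ ℚ.* ℚ.∣ s ∣ ℚ.≤ δ ℚ.* B
  second = ℚ.≤-trans
    (ℚ.*-monoʳ-≤-nonNeg ℚ.∣ s ∣ {{ℚ.∣-∣-nonNeg s}} (ℚ.<⇒≤ ∣p-q∣<δ))
    (ℚ.*-monoˡ-≤-nonNeg δ {{ℚ.nonNegative (ℚ.<⇒≤ 0<δ)}} ∣s∣≤B)
  third : A ℚ.* ℚ.∣ r ℚ.- s ∣ ℚ.< A ℚ.* δ
  third = ℚ.*-monoʳ-<-pos A {{ℚ.positive 0<A}} ∣r-s∣<δ

_*ᴿ_ : ℝ → ℝ → ℝ
(x *ᴿ y) .seq n = seq x n ℚ.* seq y n
(x *ᴿ y) .cauchy ε 0<ε =
  let A , 0<A , M₁ , xBound = eventuallyBounded x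
      B , 0<B , M₂ , yBound = eventuallyBounded y
      δ , 0<δ , δC≡ε = quotient ε (A ℚ.+ B) 0<ε (ℚ.+-mono-< 0<A 0<B)
      M₃ , xClose = cauchy x δ 0<δ
      M₄ , yClose = cauchy y δ 0<δ
  in (M₁ ℕ.⊔ M₂) ℕ.⊔ (M₃ ℕ.⊔ M₄) , λ m n M≤m M≤n →
      subst (ℚ.∣ seq x m ℚ.* seq y m ℚ.- seq x n ℚ.* seq y n ∣ ℚ.<_) δC≡ε
        (product-close (seq x m) (seq x n) (seq y m) (seq y n) 0<A 0<δ
          (xBound m (ℕ.m⊔n≤o⇒m≤o M₁ M₂ (ℕ.m⊔n≤o⇒m≤o _ _ M≤m)))
          (yBound n (ℕ.m⊔n≤o⇒n≤o M₁ M₂ (ℕ.m⊔n≤o⇒m≤o _ _ M≤n)))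
          (xClose m n (ℕ.m⊔n≤o⇒m≤o M₃ M₄ (ℕ.m⊔n≤o⇒n≤o (M₁ ℕ.⊔ M₂) _ M≤m))
                      (ℕ.m⊔n≤o⇒m≤o M₃ M₄ (ℕ.m⊔n≤o⇒n≤o (M₁ ℕ.⊔ M₂) _ M≤n)))
          (yClose m n (ℕ.m⊔n≤o⇒n≤o M₃ M₄ (ℕ.m⊔n≤o⇒n≤o (M₁ ℕ.⊔ M₂) _ M≤m))
                      (ℕ.m⊔n≤o⇒n≤o M₃ M₄ (ℕ.m⊔n≤o⇒n≤o (M₁ ℕ.⊔ M₂) _ M≤n))))

/-mono-< : ∀ a b c d .{{_ : NonZero b}} .{{_ : NonZero d}} →
           a ℕ.* d ℕ.< c ℕ.* b → (+ a ℚ./ b) ℚ.< (+ c ℚ./ d)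
/-mono-< a (suc b) c (suc d) ad<cb = ℚ.toℚᵘ-cancel-<
  (ℚᵘ.<-respˡ-≃ (ℚᵘ.≃-sym (ℚ.toℚᵘ-fromℚᵘ (ℚᵘ.mkℚᵘ (+ a) b)))
  (ℚᵘ.<-respʳ-≃ (ℚᵘ.≃-sym (ℚ.toℚᵘ-fromℚᵘ (ℚᵘ.mkℚᵘ (+ c) d)))
  (ℚᵘ.*<* (subst₂ ℤ._<_ (ℤ.pos-* a (suc d)) (ℤ.pos-* c (suc b)) (ℤ.+<+ ad<cb)))))

/-distribʳ-+ : ∀ a b d .{{_ : NonZero d}} → (+ (a ℕ.+ b) ℚ./ d) ≡ (+ a ℚ./ d) ℚ.+ (+ b ℚ./ d)
/-distribʳ-+ a b (suc d) = ℚ.toℚᵘ-injective (begin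
  ℚ.toℚᵘ (ℚ.fromℚᵘ (ℚᵘ.mkℚᵘ (+ (a ℕ.+ b)) d))                ≈⟨ ℚ.toℚᵘ-fromℚᵘ _ ⟩
  ℚᵘ.mkℚᵘ (+ (a ℕ.+ b)) d                                    ≈⟨ ℚᵘ.*≡* (expand (+ a) (+ b) (+ suc d)) ⟩
  ℚᵘ.mkℚᵘ (+ a) d ℚᵘ.+ ℚᵘ.mkℚᵘ (+ b) d
    ≈⟨ ℚᵘ.+-cong (ℚᵘ.≃-sym (ℚ.toℚᵘ-fromℚᵘ (ℚᵘ.mkℚᵘ (+ a) d))) (ℚᵘ.≃-sym (ℚ.toℚᵘ-fromℚᵘ (ℚᵘ.mkℚᵘ (+ b) d))) ⟩
  ℚ.toℚᵘ (+ a ℚ./ suc d) ℚᵘ.+ ℚ.toℚᵘ (+ b ℚ./ suc d)         ≈⟨ ℚ.toℚᵘ-homo-+ (+ a ℚ./ suc d) (+ b ℚ./ suc d) ⟨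
  ℚ.toℚᵘ ((+ a ℚ./ suc d) ℚ.+ (+ b ℚ./ suc d))               ∎)
  where
  open ℚᵘ.≃-Reasoning
  expand : ∀ x y z → (x ℤ.+ y) ℤ.* (z ℤ.* z) ≡ (x ℤ.* z ℤ.+ y ℤ.* z) ℤ.* z
  expand = solve 3 (λ x y z → (x :+ y) :* (z :* z) := (x :* z :+ y :* z) :* z) refl
    where open ℤSolver

/-gap : ∀ a b c d .{{_ : NonZero b}} .{{_ : NonZero d}} → a ℕ.* d ℕ.< suc c ℕ.* b →
        (+ a ℚ./ b) ℚ.- (+ c ℚ./ d) ℚ.< (+ 1 ℚ./ d)
/-gap a b c d ad<[1+c]b = subst ((+ a ℚ./ b) ℚ.- (+ c ℚ./ d) ℚ.<_)
  (trans (cong (ℚ._- (+ c ℚ./ d)) (/-distribʳ-+ 1 c d)) (cancel (+ 1 ℚ./ d) (+ c ℚ./ d)))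
  (ℚ.+-monoˡ-< (ℚ.- (+ c ℚ./ d)) (/-mono-< a b (suc c) d ad<[1+c]b))
  where
  cancel : ∀ p q → (p ℚ.+ q) ℚ.- q ≡ p
  cancel = solve 2 (λ p q → (p :+ q) :- q := p) refl
    where open ℚSolver

archimedean : ∀ ε → 0ℚ ℚ.< ε → ∃ λ M → ∀ n → M ℕ.≤ n → (+ 1 ℚ./ suc n) ℚ.< ε
archimedean ε 0<ε = ℚ.↧ₙ ε , λ n M≤n → small n M≤n
  where
  numerator : ∀ p → .{{ℚ.Positive p}} → ∃ λ k → (+ suc k ℚ./ ℚ.↧ₙ p) ≡ p
  numerator p@(ℚ.mkℚ (ℤ.+[1+ k ]) _ _) = k , ℚ.↥p/↧p≡p p
  small : ∀ n → ℚ.↧ₙ ε ℕ.≤ n → (+ 1 ℚ./ suc n) ℚ.< ε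
  small n M≤n with numerator ε {{ℚ.positive 0<ε}}
  ... | k , eq = subst ((+ 1 ℚ./ suc n) ℚ.<_) eq (/-mono-< 1 (suc n) (suc k) (ℚ.↧ₙ ε) (begin-strict
    1 ℕ.* ℚ.↧ₙ ε     ≡⟨ ℕ.*-identityˡ _ ⟩
    ℚ.↧ₙ ε           ≤⟨ M≤n ⟩
    n                <⟨ ℕ.n<1+n n ⟩
    suc n            ≤⟨ ℕ.m≤n*m (suc n) (suc k) ⟩
    suc k ℕ.* suc n  ∎))
    where open ℕ.≤-Reasoning

∣-∣<⁺ : ∀ p q {ε} → p ℚ.- q ℚ.< ε → q ℚ.- p ℚ.< ε → ℚ.∣ p ℚ.- q ∣ ℚ.< ε
∣-∣<⁺ p q {ε} p-q<ε q-p<ε with ℚ.∣p∣≡p∨∣p∣≡-p (p ℚ.- q)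
... | inj₁ eq = subst (ℚ._< ε) (sym eq) p-q<ε
... | inj₂ eq = subst (ℚ._< ε) (sym (trans eq (flip- p q))) q-p<ε
  where
  flip- : ∀ p q → ℚ.- (p ℚ.- q) ≡ q ℚ.- p
  flip- = solve 2 (λ p q → :- (p :- q) := q :- p) refl
    where open ℚSolver

n<2^[1+⌊log₂n⌋] : ∀ n → n ℕ.< 2 ℕ.^ suc ⌊log₂ n ⌋
n<2^[1+⌊log₂n⌋] n = ℕ.≰⇒> λ 2^l≤n → ℕ.<-irrefl refl (begin-strict
  ⌊log₂ n ⌋                          <⟨ ℕ.n<1+n _ ⟩
  suc ⌊log₂ n ⌋                      ≡⟨ ⌊log₂[2^n]⌋≡n (suc ⌊log₂ n ⌋) ⟨
  ⌊log₂ 2 ℕ.^ suc ⌊log₂ n ⌋ ⌋        ≤⟨ ⌊log₂⌋-mono-≤ 2^l≤n ⟩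
  ⌊log₂ n ⌋                          ∎)
  where open ℕ.≤-Reasoning

2^k≤n : ∀ k n .{{_ : NonZero n}} → k ℕ.≤ ⌊log₂ n ⌋ → 2 ℕ.^ k ℕ.≤ n
2^k≤n zero    n       _   = ℕ.>-nonZero⁻¹ n
2^k≤n (suc k) n       k<l = begin
  2 ℕ.* 2 ℕ.^ k           ≤⟨ ℕ.*-monoʳ-≤ 2 (2^k≤n k ℕ.⌊ n /2⌋ {{half≢0}} half) ⟩
  2 ℕ.* ℕ.⌊ n /2⌋         ≡⟨ cong (ℕ.⌊ n /2⌋ ℕ.+_) (ℕ.+-identityʳ _) ⟩
  ℕ.⌊ n /2⌋ ℕ.+ ℕ.⌊ n /2⌋ ≤⟨ ℕ.+-monoʳ-≤ ℕ.⌊ n /2⌋ (ℕ.⌊n/2⌋≤⌈n/2⌉ n) ⟩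
  ℕ.⌊ n /2⌋ ℕ.+ ℕ.⌈ n /2⌉ ≡⟨ ℕ.⌊n/2⌋+⌈n/2⌉≡n n ⟩
  n                       ∎
  where
  open ℕ.≤-Reasoning
  half : k ℕ.≤ ⌊log₂ ℕ.⌊ n /2⌋ ⌋
  half = subst (k ℕ.≤_) (sym (⌊log₂⌊n/2⌋⌋≡⌊log₂n⌋∸1 n)) (ℕ.∸-monoˡ-≤ 1 k<l)
  nonZeroHalf : ∀ m → suc k ℕ.≤ ⌊log₂ m ⌋ → NonZero ℕ.⌊ m /2⌋
  nonZeroHalf (suc (suc m)) _ = _
  half≢0 : NonZero ℕ.⌊ n /2⌋
  half≢0 = nonZeroHalf n k<l

module _ (a : ℕ) .{{a≢0 : NonZero a}} where

  private
    L : ℕ → ℕ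
    L k = ⌊log₂ (a ℕ.^ k) ⌋

  ⌊log₂⌋-slope : ∀ m k .{{_ : NonZero k}} .{{_ : NonZero m}} → L m ℕ.* k ℕ.< suc (L k) ℕ.* m
  ⌊log₂⌋-slope m k = ℕ.≰⇒> λ L[k]+1≤ → ℕ.<-irrefl refl (begin-strict
    2 ℕ.^ (L m ℕ.* k)        ≡⟨ ℕ.^-*-assoc 2 (L m) k ⟨
    (2 ℕ.^ L m) ℕ.^ k        ≤⟨ ℕ.^-monoˡ-≤ k (2^k≤n (L m) (a ℕ.^ m) {{ℕ.m^n≢0 a m}} ℕ.≤-refl) ⟩
    (a ℕ.^ m) ℕ.^ k          ≡⟨ ℕ.^-*-assoc a m k ⟩
    a ℕ.^ (m ℕ.* k)          ≡⟨ cong (a ℕ.^_) (ℕ.*-comm m k) ⟩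
    a ℕ.^ (k ℕ.* m)          ≡⟨ ℕ.^-*-assoc a k m ⟨
    (a ℕ.^ k) ℕ.^ m          <⟨ ℕ.^-monoˡ-< m (n<2^[1+⌊log₂n⌋] (a ℕ.^ k)) ⟩
    (2 ℕ.^ suc (L k)) ℕ.^ m  ≡⟨ ℕ.^-*-assoc 2 (suc (L k)) m ⟩
    2 ℕ.^ (suc (L k) ℕ.* m)  ≤⟨ ℕ.^-monoʳ-≤ 2 L[k]+1≤ ⟩
    2 ℕ.^ (L m ℕ.* k)        ∎)
    where open ℕ.≤-Reasoning

  -- ⌊log₂ aⁿ⌋ / n ≤ log₂ a < (⌊log₂ aⁿ⌋ + 1) / n, so these quotients converge
  -- to log₂ a; the index is shifted to keep n positive.
  log₂ : ℝ
  log₂ .seq k = + ⌊log₂ (a ℕ.^ suc k) ⌋ ℚ./ suc k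
  log₂ .cauchy ε 0<ε =
    let M , small = archimedean ε 0<ε
        gap : ∀ m k → M ℕ.≤ k → seq log₂ m ℚ.- seq log₂ k ℚ.< ε
        gap m k M≤k = ℚ.<-trans
          (/-gap (L (suc m)) (suc m) (L (suc k)) (suc k) (⌊log₂⌋-slope (suc m) (suc k)))
          (small k M≤k)
    in M , λ m n M≤m M≤n → ∣-∣<⁺ (seq log₂ m) (seq log₂ n) (gap m n M≤n) (gap n m M≤m)

module ℚSum = Algebra.Properties.CommutativeMonoid.Sum ℚ.+-0-commutativeMonoid

record FiniteAbelianGroup : Set₁ where
  field
    abelianGroup : AbelianGroup 0ℓ 0ℓ
    order        : ℕ
    enumeration  : Inverse (≡.setoid (Fin order)) (AbelianGroup.setoid abelianGroup)

least : ∀ {P : Pred ℕ 0ℓ} → Decidable P → ∀ n → P n → ∃ λ m → P m × (∀ k → k ℕ.< m → ¬ P k)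
least P? zero    p = zero , p , λ _ ()
least P? (suc n) p with P? zero
... | yes p₀ = zero , p₀ , λ _ ()
... | no ¬p₀ with least (P? ∘ suc) n p
...   | m , pₘ , below = suc m , pₘ , λ where
        zero    _         → ¬p₀
        (suc k) (s≤s k<m) → below k k<m

allSubset? : ∀ {n} {P : Pred (Subset n) 0ℓ} → Decidable P → Dec (∀ I → P I)
allSubset? P? with Subset.anySubset? (¬? ∘ P?)
... | yes (I , ¬p) = no λ all → ¬p (all I)
... | no  none     = yes λ I → decidable-stable (P? I) λ ¬p → none (I , ¬p)

Disjoint : ∀ {n} → Subset n → Subset n → Set
Disjoint I J = Empty (I ∩ J)

∉─ : ∀ {n} {x : Fin n} (I J : Subset n) → x ∈ I ─ J → x ∉ J
∉─ (_ ∷ I) (_ ∷ J) (there x∈I─J) (there x∈J) = ∉─ I J x∈I─J x∈J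
∉─ (_ ∷ I) (_ ∷ J) () here

⊆─⇒disjoint : ∀ {n} (I J : Subset n) {K} → K ⊆ I ─ J → Disjoint J K
⊆─⇒disjoint I J {K} K⊆I─J (x , x∈J∩K) =
  let x∈J , x∈K = Subset.x∈p∩q⁻ J K x∈J∩K in ∉─ I J (K⊆I─J x∈K) x∈J

minimum : ∀ {n} (I : Subset n) → Nonempty I → ∃ λ i → i ∈ I × (∀ {j} → j ∈ I → i Fin.≤ j)
minimum (inside  ∷ I) _ = zero , here , λ _ → z≤n
minimum (outside ∷ I) (suc x , there x∈I) with minimum I (x , x∈I)
... | i , i∈I , below = suc i , there i∈I , λ { (there j∈I) → s≤s (below j∈I) }

⟦_⟧ : ∀ {n} {P : Pred (Fin n) 0ℓ} → Decidable P → Subset n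
⟦ P? ⟧ = Vec.tabulate (does ∘ P?)

module _ {n} {P : Pred (Fin n) 0ℓ} (P? : Decidable P) where

  ∈⟦⟧⁺ : ∀ {i} → P i → i ∈ ⟦ P? ⟧
  ∈⟦⟧⁺ {i} p = Vec.lookup⇒[]= i ⟦ P? ⟧ (trans (Vec.lookup∘tabulate _ i) (dec-true (P? i) p))

  ∈⟦⟧⁻ : ∀ {i} → i ∈ ⟦ P? ⟧ → P i
  ∈⟦⟧⁻ {i} i∈ with P? i | trans (sym (Vec.lookup∘tabulate (does ∘ P?) i)) (Vec.[]=⇒lookup i∈)
  ... | yes p | _ = p

-- The t smallest elements of I.
first : ∀ {n} → ℕ → Subset n → Subset n
first zero    I             = ∅
first (suc t) []            = []
first (suc t) (inside  ∷ I) = inside ∷ first t I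
first (suc t) (outside ∷ I) = outside ∷ first (suc t) I

first⊆ : ∀ {n} t (I : Subset n) → first t I ⊆ I
first⊆ zero    I             x∈          = contradiction x∈ Subset.∉⊥
first⊆ (suc t) (inside  ∷ I) here        = here
first⊆ (suc t) (inside  ∷ I) (there x∈)  = there (first⊆ t I x∈)
first⊆ (suc t) (outside ∷ I) (there x∈)  = there (first⊆ (suc t) I x∈)

first-mono : ∀ {n t u} (I : Subset n) → t ℕ.≤ u → first t I ⊆ first u I
first-mono               I             z≤n       x∈         = contradiction x∈ Subset.∉⊥
first-mono               (inside  ∷ I) (s≤s t≤u) here       = here
first-mono               (inside  ∷ I) (s≤s t≤u) (there x∈) = there (first-mono I t≤u x∈)
first-mono               (outside ∷ I) (s≤s t≤u) (there x∈) = there (first-mono I (s≤s t≤u) x∈)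

first-strict : ∀ {n t u} (I : Subset n) → t ℕ.< u → u ℕ.≤ ∣ I ∣ → ∃ λ x → x ∈ first u I × x ∉ first t I
first-strict {u = suc u} (outside ∷ I) t<u u≤∣I∣ with first-strict I t<u u≤∣I∣
first-strict {t = zero}  (outside ∷ I) t<u u≤∣I∣ | x , x∈ , x∉ = suc x , there x∈ , λ { (there x∈′) → x∉ x∈′ }
first-strict {t = suc t} (outside ∷ I) (s≤s t<u) u≤∣I∣ | x , x∈ , x∉ = suc x , there x∈ , λ { (there x∈′) → x∉ x∈′ }
first-strict {t = zero} {suc u} (inside ∷ I) t<u _ = zero , here , λ ()
first-strict {t = suc t} {suc u} (inside ∷ I) (s≤s t<u) (s≤s u≤∣I∣) with first-strict I t<u u≤∣I∣
... | x , x∈ , x∉ = suc x , there x∈ , λ { (there x∈′) → x∉ x∈′ }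

module ZeroSum (G : FiniteAbelianGroup) where

  open FiniteAbelianGroup G
  open AbelianGroup abelianGroup
    renaming (_∙_ to _+_; ε to 0#; _⁻¹ to -_; ∙-cong to +-cong; ∙-congˡ to +-congˡ; ∙-congʳ to +-congʳ;
              identityˡ to +-identityˡ; refl to ≈-refl; sym to ≈-sym; trans to ≈-trans; identityʳ to +-identityʳ)
    hiding (_-_)
  open Inverse enumeration using (to; from; from-cong; strictlyInverseˡ)
  open Algebra.Properties.CommutativeMonoid.Sum commutativeMonoid using (sum-cong-≋) renaming (sum to ∑)
  open Algebra.Properties.CommutativeSemigroup commutativeSemigroup using (interchange)
  open Algebra.Properties.Group group using (identityʳ-unique)
  open Algebra.Properties.Monoid.Mult monoid using (×-homo-+; ×-congʳ) renaming (_×_ to _·_)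
  open Relation.Binary.Reasoning.Setoid setoid

  _≟_ : ∀ x y → Dec (x ≈ y)
  x ≟ y = map′
    (λ eq → ≈-trans (≈-sym (strictlyInverseˡ x)) (≈-trans (reflexive (cong to eq)) (strictlyInverseˡ y)))
    from-cong (from x Fin.≟ from y)

  torsion : ∀ g → ∃ λ m → suc m · g ≈ 0#
  torsion g with Fin.pigeonhole (ℕ.n<1+n order) (λ i → from (toℕ i · g))
  ... | i , j , i<j , eq = proj₁ gap , identityʳ-unique (toℕ i · g) (suc (proj₁ gap) · g) (begin
    toℕ i · g + suc (proj₁ gap) · g      ≈⟨ ×-homo-+ g (toℕ i) (suc (proj₁ gap)) ⟨
    (toℕ i ℕ.+ suc (proj₁ gap)) · g      ≡⟨ cong (_· g) (proj₂ gap) ⟩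
    toℕ j · g                            ≈⟨ strictlyInverseˡ (toℕ j · g) ⟨
    to (from (toℕ j · g))                ≡⟨ cong to eq ⟨
    to (from (toℕ i · g))                ≈⟨ strictlyInverseˡ (toℕ i · g) ⟩
    toℕ i · g                            ∎)
    where
    gap : ∃ λ m → toℕ i ℕ.+ suc m ≡ toℕ j
    gap = toℕ j ℕ.∸ suc (toℕ i) , trans (ℕ.+-suc (toℕ i) _) (ℕ.m+[n∸m]≡n i<j)

  abstract
    leastPeriod : ∀ g → ∃ λ m → suc m · g ≈ 0# × (∀ k → k ℕ.< m → ¬ suc k · g ≈ 0#)
    leastPeriod g = least (λ m → (suc m · g) ≟ 0#) (proj₁ (torsion g)) (proj₂ (torsion g))

  ord : Carrier → ℕ
  ord g = suc (proj₁ (leastPeriod g))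

  ord-cong : ∀ {g h} → g ≈ h → ord g ≡ ord h
  ord-cong {g} {h} g≈h with leastPeriod g | leastPeriod h
  ... | m , mg≈0 , below-m | n , nh≈0 , below-n with ℕ.<-cmp m n
  ...   | tri< m<n _ _ = contradiction (≈-trans (×-congʳ (suc m) (≈-sym g≈h)) mg≈0) (below-n m m<n)
  ...   | tri≈ _ m≡n _ = cong suc m≡n
  ...   | tri> _ _ m>n = contradiction (≈-trans (×-congʳ (suc n) g≈h) nh≈0) (below-m n m>n)

  Nonzero : ∀ {ℓ} → Vector Carrier ℓ → Set
  Nonzero S = ∀ i → ¬ S i ≈ 0#

  -- An indexed multiset is a vector S, the submultiset S(I) is represented by
  -- the pair of S and I, and σ S I is the sum of the S i with i in I.
  σ : ∀ {ℓ} → Vector Carrier ℓ → Subset ℓ → Carrier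
  σ S I = ∑ λ i → if lookup I i then S i else 0#

  IsZeroSum : ∀ {ℓ} → Vector Carrier ℓ → Set
  IsZeroSum S = σ S ⊤ ≈ 0#

  IsZeroSumFree : ∀ {ℓ} → Vector Carrier ℓ → Set
  IsZeroSumFree S = ∀ I → Nonempty I → ¬ σ S I ≈ 0#

  IsMinimalZeroSum : ∀ {ℓ} → Vector Carrier ℓ → Subset ℓ → Set
  IsMinimalZeroSum S I = σ S I ≈ 0# × (∀ J → Nonempty J → J ⊂ I → ¬ σ S J ≈ 0#)

  record IrreducibleFactorization {ℓ} (S : Vector Carrier ℓ) : Set where
    field
      blocks   : List (Subset ℓ)
      nonempty : All Nonempty blocks
      minimal  : All (IsMinimalZeroSum S) blocks
      disjoint : AllPairs Disjoint blocks
      covering : ∀ i → Any (i ∈_) blocks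

  open IrreducibleFactorization public

  _~_ : ∀ {ℓ} {S : Vector Carrier ℓ} → IrreducibleFactorization S → IrreducibleFactorization S → Set
  F ~ F′ = ∀ I → I List∈.∈ blocks F ⇔ I List∈.∈ blocks F′

  IsUFIM : ∀ {ℓ} → Vector Carrier ℓ → Set
  IsUFIM S = Nonzero S × IsZeroSum S × ∃ λ (F : IrreducibleFactorization S) → ∀ F′ → F ~ F′

  crossNumber : ∀ {ℓ} → Vector Carrier ℓ → ℚ
  crossNumber S = ℚSum.sum λ i → + 1 ℚ./ ord (S i)

  IsMaxCrossNumber : (∀ {ℓ} → Vector Carrier ℓ → Set) → ℚ → Set
  IsMaxCrossNumber P x =
    (∃₂ λ ℓ (S : Vector Carrier ℓ) → P S × crossNumber S ≡ x) ×
    (∀ {ℓ} (S : Vector Carrier ℓ) → P S → crossNumber S ℚ.≤ x)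

  module _ {ℓ} {S T : Vector Carrier ℓ} (S≈T : ∀ i → S i ≈ T i) where

    σ-cong : ∀ I → σ S I ≈ σ T I
    σ-cong I = sum-cong-≋ (λ i → pick (lookup I i) i)
      where
      pick : ∀ b i → (if b then S i else 0#) ≈ (if b then T i else 0#)
      pick true  i = S≈T i
      pick false i = ≈-refl

  crossNumber-cong : ∀ {ℓ} {S T : Vector Carrier ℓ} → (∀ i → S i ≈ T i) → crossNumber S ≡ crossNumber T
  crossNumber-cong {S = S} {T} S≈T = ℚSum.sum-cong-≗ λ i →
    cong (λ m → + 1 ℚ./ suc m) (ℕ.suc-injective (ord-cong (S≈T i)))

  σ-─ : ∀ {ℓ} (S : Vector Carrier ℓ) (I J : Subset ℓ) → J ⊆ I → σ S I ≈ σ S J + σ S (I ─ J)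
  σ-─ S []      []      _   = ≈-sym (+-identityˡ 0#)
  σ-─ S (b ∷ I) (c ∷ J) J⊆I = ≈-trans
    (+-cong (head b c J⊆I) (σ-─ (S ∘ suc) I J (Subset.drop-∷-⊆ J⊆I)))
    (interchange _ _ _ _)
    where
    s = S zero
    head : ∀ b c → c ∷ J ⊆ b ∷ I →
           (if b then s else 0#) ≈ (if c then s else 0#) + (if Vec.head ((b ∷ I) ─ (c ∷ J)) then s else 0#)
    head true  true  _ = ≈-sym (+-identityʳ s)
    head true  false _ = ≈-sym (+-identityˡ s)
    head false false _ = ≈-sym (+-identityʳ 0#)
    head false true  p with () ← p here

  σ-∅ : ∀ {ℓ} (S : Vector Carrier ℓ) → σ S ∅ ≈ 0#
  σ-∅ {zero}  S = ≈-refl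
  σ-∅ {suc ℓ} S = ≈-trans (+-identityˡ _) (σ-∅ (S ∘ suc))

  σ-⁅⁆ : ∀ {ℓ} (S : Vector Carrier ℓ) i → σ S ⁅ i ⁆ ≈ S i
  σ-⁅⁆ S zero    = ≈-trans (+-congˡ (σ-∅ (S ∘ suc))) (+-identityʳ _)
  σ-⁅⁆ S (suc i) = ≈-trans (+-identityˡ _) (σ-⁅⁆ (S ∘ suc) i)

  σ-─≈0 : ∀ {ℓ} (S : Vector Carrier ℓ) (I J : Subset ℓ) → J ⊆ I → σ S I ≈ σ S J → σ S (I ─ J) ≈ 0#
  σ-─≈0 S I J J⊆I eq = identityʳ-unique (σ S J) (σ S (I ─ J)) (≈-trans (≈-sym (σ-─ S I J J⊆I)) eq)

  zeroSumFree-size : ∀ {ℓ} (S : Vector Carrier ℓ) I →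
                     (∀ J → Nonempty J → J ⊆ I → ¬ σ S J ≈ 0#) → ∣ I ∣ ℕ.≤ order
  zeroSumFree-size S I free = ℕ.≮⇒≥ λ order<∣I∣ →
    let t , u , t<u , eq = Fin.pigeonhole order<∣I∣ (λ t → from (σ S (first (toℕ t) I)))
        J = first (toℕ u) I ; J′ = first (toℕ t) I
        J′⊆J = first-mono I (ℕ.<⇒≤ t<u)
        x , x∈J , x∉J′ = first-strict I t<u (Fin.toℕ≤n u)
        σJ≈σJ′ : σ S J ≈ σ S J′
        σJ≈σJ′ = ≈-trans (≈-sym (strictlyInverseˡ (σ S J)))
                   (≈-trans (reflexive (cong to (sym eq))) (strictlyInverseˡ (σ S J′)))
    in free (J ─ J′) (x , Subset.x∈p∧x∉q⇒x∈p─q x∈J x∉J′)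
         (first⊆ (toℕ u) I ∘ Subset.p─q⊆p J J′)
         (σ-─≈0 S J J′ J′⊆J σJ≈σJ′)

  module _ {ℓ} (S : Vector Carrier ℓ) where

    Block : Subset ℓ → Set
    Block I = Nonempty I × IsMinimalZeroSum S I

    block? : Decidable Block
    block? I = Subset.nonempty? I ×-dec (σ S I ≟ 0# ×-dec allSubset? λ J →
      Subset.nonempty? J →-dec (J Subset.⊂? I →-dec ¬? (σ S J ≟ 0#)))

    minimalBlock : ∀ I → Nonempty I → σ S I ≈ 0# → ∃ λ J → J ⊆ I × Block J
    minimalBlock I = go I (⊂-wellFounded I)
      where
      go : ∀ I → Acc _⊂_ I → Nonempty I → σ S I ≈ 0# → ∃ λ J → J ⊆ I × Block J
      go I (acc rec) I≢∅ σI≈0 with Subset.anySubset?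
        (λ J → Subset.nonempty? J ×-dec (J Subset.⊂? I ×-dec (σ S J ≟ 0#)))
      ... | no  none = I , (λ x∈I → x∈I) , I≢∅ , σI≈0 , λ J J≢∅ J⊂I σJ≈0 → none (J , J≢∅ , J⊂I , σJ≈0)
      ... | yes (J , J≢∅ , J⊂I , σJ≈0) with go J (rec J⊂I) J≢∅ σJ≈0
      ...   | B , B⊆J , block = B , proj₁ J⊂I ∘ B⊆J , block

    factor : ∀ I → σ S I ≈ 0# → ∃ λ Bs →
             All Block Bs × AllPairs Disjoint Bs × All (_⊆ I) Bs × (∀ i → i ∈ I → Any (i ∈_) Bs)
    factor I = go I (⊂-wellFounded I)
      where
      go : ∀ I → Acc _⊂_ I → σ S I ≈ 0# → ∃ λ Bs →
           All Block Bs × AllPairs Disjoint Bs × All (_⊆ I) Bs × (∀ i → i ∈ I → Any (i ∈_) Bs)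
      go I (acc rec) σI≈0 with Subset.nonempty? I
      ... | no  I≡∅ = [] , [] , [] , [] , λ i i∈I → contradiction (i , i∈I) I≡∅
      ... | yes I≢∅ with minimalBlock I I≢∅ σI≈0
      ...   | B , B⊆I , block@((x , x∈B) , σB≈0 , _)
        with go (I ─ B) (rec (Subset.p∩q≢∅⇒p─q⊂p I B (x , Subset.x∈p∩q⁺ (B⊆I x∈B , x∈B))))
                (σ-─≈0 S I B B⊆I (≈-trans σI≈0 (≈-sym σB≈0)))
      ...     | Bs , blocks , disj , within , cover =
        B ∷ Bs , block ∷ blocks ,
        All.map (λ {C} (C⊆I─B : C ⊆ I ─ B) → ⊆─⇒disjoint I B C⊆I─B) within ∷ disj ,
        B⊆I ∷ All.map {P = _⊆ (I ─ B)} {Q = _⊆ I} (λ {C} C⊆I─B → Subset.⊆-trans {i = C} C⊆I─B (Subset.p─q⊆p I B)) within ,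
        λ i i∈I → coverI i i∈I (i Subset.∈? B)
        where
        coverI : ∀ i → i ∈ I → Dec (i ∈ B) → Any (i ∈_) (B ∷ Bs)
        coverI i i∈I (yes i∈B) = here i∈B
        coverI i i∈I (no  i∉B) = there (cover i (Subset.x∈p∧x∉q⇒x∈p─q i∈I i∉B))

    -- For zero-sum S this is equivalent to uniqueness of the factorization: any
    -- block extends to a factorization, and two intersecting blocks that differ
    -- would give two of them.  It makes IsUFIM decidable and bounds the length.
    BlocksDisjoint : Set
    BlocksDisjoint = ∀ I J → Block I → Block J → Nonempty (I ∩ J) → I ≡ J

    blocksDisjoint? : Dec BlocksDisjoint
    blocksDisjoint? = allSubset? λ I → allSubset? λ J →
      block? I →-dec (block? J →-dec (Subset.nonempty? (I ∩ J) →-dec Vec.≡-dec Bool._≟_ I J))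

    factorization : IsZeroSum S → IrreducibleFactorization S
    factorization σ≈0 = let Bs , isBlock , disj , _ , cover = factor ⊤ σ≈0 in record
      { blocks   = Bs
      ; nonempty = All.map proj₁ isBlock
      ; minimal  = All.map proj₂ isBlock
      ; disjoint = disj
      ; covering = λ i → cover i Subset.∈⊤
      }

    factorizationThrough : IsZeroSum S → ∀ I → Block I →
                           ∃ λ (F : IrreducibleFactorization S) → I List∈.∈ blocks F
    factorizationThrough σ≈0 I block@(I≢∅ , σI≈0 , min) =
      let Bs , isBlock , disj , within , cover = factor (⊤ ─ I) (σ-─≈0 S ⊤ I Subset.⊆⊤ (≈-trans σ≈0 (≈-sym σI≈0)))
          coverI : ∀ i → Dec (i ∈ I) → Any (i ∈_) (I ∷ Bs)
          coverI i = λ where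
            (yes i∈I) → here i∈I
            (no  i∉I) → there (cover i (Subset.x∈p∧x∉q⇒x∈p─q Subset.∈⊤ i∉I))
      in record
      { blocks   = I ∷ Bs
      ; nonempty = I≢∅ ∷ All.map proj₁ isBlock
      ; minimal  = (σI≈0 , min) ∷ All.map proj₂ isBlock
      ; disjoint = All.map (λ {C} (C⊆⊤─I : C ⊆ ⊤ ─ I) → ⊆─⇒disjoint ⊤ I C⊆⊤─I) within ∷ disj
      ; covering = λ i → coverI i (i Subset.∈? I)
      } , here refl

    module _ (F : IrreducibleFactorization S) where

      isBlock : ∀ {B} → B List∈.∈ blocks F → Block B
      isBlock B∈F = All.lookup (nonempty F) B∈F , All.lookup (minimal F) B∈F

      blockOf : ∀ i → ∃ λ B → B List∈.∈ blocks F × i ∈ B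
      blockOf i = List∈.find (covering F i)

    pairwise : ∀ {Bs : List (Subset ℓ)} → AllPairs Disjoint Bs →
               ∀ {I J} → I List∈.∈ Bs → J List∈.∈ Bs → Nonempty (I ∩ J) → I ≡ J
    pairwise (d ∷ ds) (here refl) (here refl) _ = refl
    pairwise (d ∷ ds) (here refl) (there J∈)    m = contradiction m (All.lookup d J∈)
    pairwise (d ∷ ds) {I} {J} (there I∈) (here refl) m =
      contradiction (subst Nonempty (Subset.∩-comm I J) m) (All.lookup d I∈)
    pairwise (d ∷ ds) (there I∈)    (there J∈)    m = pairwise ds I∈ J∈ m

    unique⇒blocksDisjoint : IsUFIM S → BlocksDisjoint
    unique⇒blocksDisjoint (_ , σ≈0 , F , unique) I J I-block J-block meet =
      let F₁ , I∈F₁ = factorizationThrough σ≈0 I I-block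
          F₂ , J∈F₂ = factorizationThrough σ≈0 J J-block
      in pairwise (disjoint F) (Equivalence.from (unique F₁ I) I∈F₁)
                               (Equivalence.from (unique F₂ J) J∈F₂) meet

    blocksDisjoint⇒unique : BlocksDisjoint → ∀ (F F′ : IrreducibleFactorization S) → F ~ F′
    blocksDisjoint⇒unique same F F′ I = mk⇔ (move F F′) (move F′ F)
      where
      move : ∀ F F′ → I List∈.∈ blocks F → I List∈.∈ blocks F′
      move F F′ I∈F =
        let (i , i∈I) , _ = isBlock F I∈F
            B , B∈F′ , i∈B = blockOf F′ i
        in subst (List∈._∈ blocks F′)
             (same B I (isBlock F′ B∈F′) (isBlock F I∈F) (i , Subset.x∈p∩q⁺ (i∈B , i∈I))) B∈F′

    isUFIM⇔ : IsUFIM S ⇔ (Nonzero S × IsZeroSum S × BlocksDisjoint)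
    isUFIM⇔ = mk⇔
      (λ ufim → proj₁ ufim , proj₁ (proj₂ ufim) , unique⇒blocksDisjoint ufim)
      (λ (S≢0 , σ≈0 , same) → S≢0 , σ≈0 , factorization σ≈0 , blocksDisjoint⇒unique same (factorization σ≈0))

    isUFIM? : Dec (IsUFIM S)
    isUFIM? = map′ (Equivalence.from isUFIM⇔) (Equivalence.to isUFIM⇔)
      (Fin.all? (λ i → ¬? (S i ≟ 0#)) ×-dec (σ S ⊤ ≟ 0#) ×-dec blocksDisjoint?)

    isZeroSumFree? : Dec (IsZeroSumFree S)
    isZeroSumFree? = allSubset? λ I → Subset.nonempty? I →-dec ¬? (σ S I ≟ 0#)

    zeroSumFree-length : IsZeroSumFree S → ℓ ℕ.≤ order
    zeroSumFree-length free = subst (ℕ._≤ order) (Subset.∣⊤∣≡n ℓ)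
      (zeroSumFree-size S ⊤ λ J J≢∅ _ → free J J≢∅)

    module _ (S≢0 : Nonzero S) (same : BlocksDisjoint) where

      -- The indices that come first in every block containing them; neither this
      -- set nor its complement contains a whole block, so each has at most
      -- `order` elements.
      Leads : Fin ℓ → Set
      Leads i = ∀ B → Block B → i ∈ B → ∀ j → j ∈ B → i Fin.≤ j

      leads? : Decidable Leads
      leads? i = allSubset? λ B → block? B →-dec (i Subset.∈? B →-dec
        Fin.all? λ j → j Subset.∈? B →-dec i Fin.≤? j)

      R : Subset ℓ
      R = ⟦ leads? ⟧

      R-free : ∀ J → Nonempty J → J ⊆ R → ¬ σ S J ≈ 0#
      R-free J J≢∅ J⊆R σJ≈0 with minimalBlock J J≢∅ σJ≈0
      ... | B , B⊆J , block@((i , i∈B) , σB≈0 , _) = S≢0 i (begin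
        S i          ≈⟨ σ-⁅⁆ S i ⟨
        σ S ⁅ i ⁆    ≡⟨ cong (σ S) (Subset.⊆-antisym (λ x∈ → subst (_∈ B) (sym (Subset.x∈⁅y⁆⇒x≡y i x∈)) i∈B) B⊆⁅i⁆) ⟩
        σ S B        ≈⟨ σB≈0 ⟩
        0#           ∎)
        where
        leads : ∀ {k} → k ∈ B → Leads k
        leads k∈B = ∈⟦⟧⁻ leads? (J⊆R (B⊆J k∈B))
        B⊆⁅i⁆ : B ⊆ ⁅ i ⁆
        B⊆⁅i⁆ {j} j∈B = subst (_∈ ⁅ i ⁆)
          (Fin.≤-antisym (leads i∈B B block i∈B j j∈B) (leads j∈B B block j∈B i i∈B)) (Subset.x∈⁅x⁆ i)

      ∁R-free : ∀ J → Nonempty J → J ⊆ ∁ R → ¬ σ S J ≈ 0#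
      ∁R-free J J≢∅ J⊆∁R σJ≈0 with minimalBlock J J≢∅ σJ≈0
      ... | B , B⊆J , block@(B≢∅ , _) with minimum B B≢∅
      ...   | i , i∈B , below = Subset.x∈∁p⇒x∉p (J⊆∁R (B⊆J i∈B)) (∈⟦⟧⁺ leads? λ C C-block i∈C j j∈C →
        below (subst (j ∈_) (same C B C-block block (i , Subset.x∈p∩q⁺ (i∈C , i∈B))) j∈C))

      blocksDisjoint-length : ℓ ℕ.≤ order ℕ.+ order
      blocksDisjoint-length = ℕ.≤-trans
        (ℕ.≤-reflexive (trans (sym (ℕ.m+[n∸m]≡n (Subset.∣p∣≤n R)))
                                (cong (∣ R ∣ ℕ.+_) (sym (Subset.∣∁p∣≡n∸∣p∣ R)))))
        (ℕ.+-mono-≤ (zeroSumFree-size S R R-free) (zeroSumFree-size S (∁ R) ∁R-free))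

    ufim-length : IsUFIM S → ℓ ℕ.≤ order ℕ.+ order
    ufim-length ufim = blocksDisjoint-length (proj₁ ufim) (unique⇒blocksDisjoint ufim)

  module _ {ℓ} {S T : Vector Carrier ℓ} (S≈T : ∀ i → S i ≈ T i) where

    nonzero-resp : Nonzero S → Nonzero T
    nonzero-resp S≢0 i Ti≈0 = S≢0 i (≈-trans (S≈T i) Ti≈0)

    σ≈0-resp : ∀ I → σ S I ≈ 0# → σ T I ≈ 0#
    σ≈0-resp I = ≈-trans (≈-sym (σ-cong S≈T I))

    σ≈0-resp⁻¹ : ∀ I → σ T I ≈ 0# → σ S I ≈ 0#
    σ≈0-resp⁻¹ I = ≈-trans (σ-cong S≈T I)

    zeroSumFree-resp : IsZeroSumFree S → IsZeroSumFree T
    zeroSumFree-resp free I I≢∅ σ≈0 = free I I≢∅ (σ≈0-resp⁻¹ I σ≈0)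

    block-resp⁻¹ : ∀ {I} → Block T I → Block S I
    block-resp⁻¹ {I} (I≢∅ , σ≈0 , min) =
      I≢∅ , σ≈0-resp⁻¹ I σ≈0 , λ J J≢∅ J⊂I σJ≈0 → min J J≢∅ J⊂I (σ≈0-resp J σJ≈0)

    ufim-resp : IsUFIM S → IsUFIM T
    ufim-resp ufim =
      let S≢0 , σ≈0 , same = Equivalence.to (isUFIM⇔ S) ufim
      in Equivalence.from (isUFIM⇔ T)
           ( nonzero-resp S≢0 , σ≈0-resp ⊤ σ≈0
           , λ I J I-block J-block → same I J (block-resp⁻¹ I-block) (block-resp⁻¹ J-block))

  vectors : ∀ ℓ → List (Vec (Fin order) ℓ)
  vectors zero    = [] ∷ []
  vectors (suc ℓ) = List.cartesianProductWith _∷_ (List.allFin order) (vectors ℓ)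

  ∈-vectors : ∀ {ℓ} (v : Vec (Fin order) ℓ) → v List∈.∈ vectors ℓ
  ∈-vectors []      = here refl
  ∈-vectors (x ∷ v) = List∈.∈-cartesianProductWith⁺ _∷_ (List∈.∈-allFin x) (∈-vectors v)

  family : ∀ {ℓ} → Vec (Fin order) ℓ → Vector Carrier ℓ
  family v i = to (lookup v i)

  code : ∀ {ℓ} → Vector Carrier ℓ → Vec (Fin order) ℓ
  code S = Vec.tabulate (from ∘ S)

  family-code : ∀ {ℓ} (S : Vector Carrier ℓ) i → S i ≈ family (code S) i
  family-code S i = ≈-trans (≈-sym (strictlyInverseˡ (S i)))
    (reflexive (cong to (sym (Vec.lookup∘tabulate (from ∘ S) i))))

  module _ (P : ∀ {ℓ} → Vector Carrier ℓ → Set)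
           (P? : ∀ {ℓ} (S : Vector Carrier ℓ) → Dec (P S))
           (P-resp : ∀ {ℓ} {S T : Vector Carrier ℓ} → (∀ i → S i ≈ T i) → P S → P T)
           (B : ℕ) (P-bounded : ∀ {ℓ} (S : Vector Carrier ℓ) → P S → ℓ ℕ.≤ B)
           (P-empty : ∀ (S : Vector Carrier 0) → P S) where

    private
      Code : Set
      Code = ∃ (Vec (Fin order))

      value : Code → ℚ
      value (_ , v) = crossNumber (family v)

      good? : Decidable (λ (c : Code) → P (family (proj₂ c)))
      good? (_ , v) = P? (family v)

      candidates good : List Code
      candidates = List.concatMap (λ ℓ → List.map (ℓ ,_) (vectors ℓ)) (List.upTo (suc B))
      good       = List.filter good? candidates

      open Extrema (DecTotalOrder.totalOrder ℚ.≤-decTotalOrder) using (argmax; argmax-all; f[xs]≤f[argmax])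

      best : Code
      best = argmax value (0 , []) good

      best-good : P (family (proj₂ best))
      best-good = argmax-all value {P = λ c → P (family (proj₂ c))} (P-empty _) (All.all-filter good? candidates)

      ∈-good : ∀ {ℓ} (S : Vector Carrier ℓ) → P S → (ℓ , code S) List∈.∈ good
      ∈-good {ℓ} S p = List∈.∈-filter⁺ good?
        (List∈.∈-concatMap⁺ (λ ℓ → List.map (ℓ ,_) (vectors ℓ))
          (List∈.lose (List∈.∈-upTo⁺ (s≤s (P-bounded S p)))
                      (List∈.∈-map⁺ (ℓ ,_) (∈-vectors (code S)))))
        (P-resp (family-code S) p)

    maxCrossNumber : ∃ (IsMaxCrossNumber P)
    maxCrossNumber =
      value best , (proj₁ best , family (proj₂ best) , best-good , refl) , λ S p →
        subst (ℚ._≤ value best) (sym (crossNumber-cong (family-code S)))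
          (All.lookup (f[xs]≤f[argmax] {f = value} (0 , []) good) (∈-good S p))

  abstract

    K₁-exists : ∃ (IsMaxCrossNumber IsUFIM)
    K₁-exists = maxCrossNumber IsUFIM isUFIM? ufim-resp (order ℕ.+ order) ufim-length
      λ S → Equivalence.from (isUFIM⇔ S) ((λ ()) , ≈-refl , λ { [] [] _ _ _ → refl })

    k-exists : ∃ (IsMaxCrossNumber λ S → Nonzero S × IsZeroSumFree S)
    k-exists = maxCrossNumber (λ S → Nonzero S × IsZeroSumFree S)
      (λ S → Fin.all? (λ i → ¬? (S i ≟ 0#)) ×-dec isZeroSumFree? S)
      (λ S≈T (S≢0 , free) → nonzero-resp S≈T S≢0 , zeroSumFree-resp S≈T free)
      order (λ S (_ , free) → zeroSumFree-length S free)
      λ S → (λ ()) , λ { [] (() , _) }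

open FiniteAbelianGroup public using (order; abelianGroup)

K₁ : FiniteAbelianGroup → ℚ
K₁ G = proj₁ (ZeroSum.K₁-exists G)

k : FiniteAbelianGroup → ℚ
k G = proj₁ (ZeroSum.k-exists G)

primeDivisors : ℕ → List ℕ
primeDivisors M = List.filter (λ p → prime? p ×-dec p ∣? M) (List.upTo (suc M))

-- For M ≥ 2 the list of prime divisors is nonempty with entries in [1 , M], so
-- the default values suc M and 1 below matter only for M < 2.
P⁻ : ℕ → ℕ
P⁻ M = ℕExtrema.min (suc M) (primeDivisors M)

P⁺ : ℕ → ℕ
P⁺ M = ℕExtrema.max 1 (primeDivisors M)

P⁺-nonZero : ∀ M → NonZero (P⁺ M)
P⁺-nonZero M = ℕ.>-nonZero (ℕExtrema.⊥≤max 1 (primeDivisors M))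

P⁻-nonZero : ∀ M → NonZero (P⁻ M)
P⁻-nonZero M = ℕExtrema.argmin-all (λ p → p) {P = NonZero} _
  (All.map (prime⇒nonZero ∘ proj₁) (All.all-filter (λ p → prime? p ×-dec p ∣? M) (List.upTo (suc M))))

-- The cyclic group of order n as the integers with congruence modulo n as their
-- equality.
ℤ/_ : ℕ → AbelianGroup 0ℓ 0ℓ
ℤ/ n = record
  { Carrier = ℤ
  ; _≈_ = _≋_
  ; _∙_ = ℤ._+_
  ; ε = ℤ.0ℤ
  ; _⁻¹ = ℤ.-_
  ; isAbelianGroup = record
    { isGroup = record
      { isMonoid = record
        { isSemigroup = record
          { isMagma = record
            { isEquivalence = record
              { refl  = λ {x} → ≡⇒≋ (refl {x = x})
              ; sym   = λ {x} {y} x≋y → subst (+ n ℤ.∣_) (negate x y) (ℤ.∣m⇒∣-m x≋y)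
              ; trans = λ {x} {y} {z} x≋y y≋z → subst (+ n ℤ.∣_) (telescope x y z) (ℤ.∣m∣n⇒∣m+n x≋y y≋z)
              }
            ; ∙-cong = λ {x} {y} {u} {v} x≋y u≋v → subst (+ n ℤ.∣_) (rearrange x y u v) (ℤ.∣m∣n⇒∣m+n x≋y u≋v)
            }
          ; assoc = λ x y z → ≡⇒≋ (ℤ.+-assoc x y z)
          }
        ; identity = (λ x → ≡⇒≋ (ℤ.+-identityˡ x)) , (λ x → ≡⇒≋ (ℤ.+-identityʳ x))
        }
      ; inverse = (λ x → ≡⇒≋ (ℤ.+-inverseˡ x)) , (λ x → ≡⇒≋ (ℤ.+-inverseʳ x))
      ; ⁻¹-cong = λ {x} {y} x≋y → subst (+ n ℤ.∣_) (distribute x y) (ℤ.∣m⇒∣-m x≋y)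
      }
    ; comm = λ x y → ≡⇒≋ (ℤ.+-comm x y)
    }
  }
  where
  open ℤSolver
  _≋_ : ℤ → ℤ → Set
  x ≋ y = + n ℤ.∣ x ℤ.- y
  ≡⇒≋ : ∀ {x y} → x ≡ y → x ≋ y
  ≡⇒≋ {x} refl = subst (+ n ℤ.∣_) (sym (ℤ.+-inverseʳ x)) (ℤ.divides ℤ.0ℤ refl)
  negate : ∀ x y → ℤ.- (x ℤ.- y) ≡ y ℤ.- x
  negate = solve 2 (λ x y → :- (x :- y) := y :- x) refl
  telescope : ∀ x y z → (x ℤ.- y) ℤ.+ (y ℤ.- z) ≡ x ℤ.- z
  telescope = solve 3 (λ x y z → (x :- y) :+ (y :- z) := x :- z) refl
  rearrange : ∀ x y u v → (x ℤ.- y) ℤ.+ (u ℤ.- v) ≡ (x ℤ.+ u) ℤ.- (y ℤ.+ v)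
  rearrange = solve 4 (λ x y u v → (x :- y) :+ (u :- v) := (x :+ u) :- (y :+ v)) refl
  distribute : ∀ x y → ℤ.- (x ℤ.- y) ≡ (ℤ.- x) ℤ.- (ℤ.- y)
  distribute = solve 2 (λ x y → :- (x :- y) := (:- x) :- (:- y)) refl

⨁ : List (AbelianGroup 0ℓ 0ℓ) → AbelianGroup 0ℓ 0ℓ
⨁ = List.foldr DirectProduct.abelianGroup Terminal.abelianGroup

_≅_ : AbelianGroup 0ℓ 0ℓ → AbelianGroup 0ℓ 0ℓ → Set
G ≅ H = ∃ (IsGroupIsomorphism (AbelianGroup.rawGroup G) (AbelianGroup.rawGroup H))

-- A component (p , es) stands for the direct sum of the cyclic groups of order
-- p ^ e with e in es.
record 𝒮 (N : ℝ) (G : FiniteAbelianGroup) : Set where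
  field
    components     : List (ℕ × List ℕ)
    distinct       : Unique (List.map proj₁ components)
    prime          : All (Prime ∘ proj₁) components
    positive       : All (All (1 ℕ.≤_) ∘ proj₂) components
    decomposition  : abelianGroup G ≅
      ⨁ (List.map (λ (p , es) → ⨁ (List.map (λ e → ℤ/ (p ℕ.^ e)) es)) components)
    exponentSum≤N  : fromℕ (sum (List.map (sum ∘ proj₂) components)) ≤ᴿ N

Ω : ℝ → FiniteAbelianGroup → Set
Ω c G = fromℕ (P⁺ (order G)) ≤ᴿ c *ᴿ fromℕ (P⁻ (order G))

module Submission where

-- Write a UFIM S as the disjoint union of its blocks and let L consist of the
-- first index of each block.  Every zero-sum part of S contains a whole block,
-- hence meets L, so S without L is zero-sum free and
-- k(S) ≤ k(G) + |L| / P⁻(|G|).  If two different subsets of L had the same sum,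
-- exchanging one for the other in a union of blocks would produce a nonempty
-- zero-sum part containing no block; hence 2^|L| ≤ |G| ≤ P⁺(|G|)^N, which
-- bounds |L|.  Conversely k(G) ≤ K₁(G), since a zero-sum free S is completed to
-- a minimal zero-sum one by -σ(S).

open import Defs
open import Algebra.Bundles using (AbelianGroup)
open import Algebra.Morphism.Structures using (IsGroupIsomorphism)
import Algebra.Properties.CommutativeMonoid.Sum
import Algebra.Properties.Group
import Algebra.Properties.Monoid.Mult
open import Data.Bool.Base using (Bool)
open import Data.Fin.Base as Fin using (Fin; zero; suc; toℕ; finToFun; funToFin)
open import Data.Fin.Permutation using (Permutation; permutation)
import Data.Fin.Properties as Fin
open import Data.Fin.Subset
  using (Subset; inside; outside; ⊤; _∈_; _∉_; _⊆_; _⊂_; _∩_; _∪_; _─_; ∁; Nonempty; Empty)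
  renaming (∣_∣ to ∣_∣ˢ)
open import Data.Fin.Subset.Induction using (⊂-wellFounded; Acc; acc)
import Data.Fin.Subset.Properties as Subset
open import Data.Integer.Base as ℤ using (+_)
import Data.Integer.Divisibility.Signed as ℤ
import Data.Integer.DivMod as ℤ
import Data.Integer.Properties as ℤ
open import Data.Integer.Solver using () renaming (module +-*-Solver to ℤSolver)
open import Data.List.Base as List using (List; []; _∷_)
open import Data.List.Extrema.Nat using (min≤xs; xs≤max)
import Data.List.Membership.Propositional as List∈
import Data.List.Membership.Propositional.Properties as List∈
open import Data.List.Relation.Unary.All as All using (All; []; _∷_)
open import Data.Nat.Base as ℕ using (ℕ; zero; suc; NonZero; NonTrivial; _≤_; _<_; s≤s)
open import Data.Nat.Divisibility using (_∣_; _∣?_; ∣-trans; ∣⇒≤; m∣m*n; >⇒∤; m%n≡0⇒n∣m)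
open import Data.Nat.DivMod using (_%_; m≡m%n+[m/n]*n; m%n<n; m/n*n≤m; m*n/n≡m; /-monoˡ-≤)
open import Data.Nat.ListAction using (sum; product)
open import Data.Nat.ListAction.Properties using (∈⇒∣product)
open import Data.Nat.Logarithm using (⌊log₂_⌋)
open import Data.Nat.Primality using (Prime; prime?; prime⇒nonZero)
open import Data.Nat.Primality.Factorisation using (PrimeFactorisation; factorise)
import Data.Nat.Properties as ℕ
open import Data.Product using (∃; _×_; _,_; proj₁; proj₂)
open import Data.Rational.Base as ℚ using (ℚ; _/_; _-_; 0ℚ; 1ℚ; ∣_∣)
import Data.Rational.Properties as ℚ
open import Data.Rational.Solver using () renaming (module +-*-Solver to ℚSolver)
import Data.Rational.Unnormalised.Base as ℚᵘ
import Data.Rational.Unnormalised.Properties as ℚᵘ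
open import Data.Sum.Base using (_⊎_; inj₁; inj₂)
open import Data.Vec.Base as Vec using ([]; _∷_; lookup; here; there)
open import Data.Vec.Functional as Vector using (Vector)
import Data.Vec.Properties as Vec
open import Function.Base using (_∘_)
open import Function.Bundles using (Inverse; Equivalence; Injection)
open import Function.Definitions using (Injective)
open import Function.Properties.Inverse using (↔⇒↣)
open import Level using (0ℓ)
open import Relation.Binary.PropositionalEquality
  using (_≡_; refl; sym; trans; cong; cong₂; subst; subst₂; module ≡-Reasoning)
import Relation.Binary.Reasoning.Setoid
open import Relation.Nullary using (¬_; yes; no; contradiction)
open import Relation.Nullary.Decidable using (_×-dec_)

open ℝ

-- Subsets

-- `S ∘ index I` makes the submultiset S(I) an indexed multiset in its own right, so that the
-- maximum k(G) can be applied to it; `extend` carries its index sets back to those of S.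
index : ∀ {n} (I : Subset n) → Fin ∣ I ∣ˢ → Fin n
index (inside  ∷ I) zero    = zero
index (inside  ∷ I) (suc i) = suc (index I i)
index (outside ∷ I) i       = suc (index I i)

extend : ∀ {n} (I : Subset n) → Subset ∣ I ∣ˢ → Subset n
extend []            J       = []
extend (inside  ∷ I) (b ∷ J) = b ∷ extend I J
extend (outside ∷ I) J       = outside ∷ extend I J

extend-⊆ : ∀ {n} (I : Subset n) J → extend I J ⊆ I
extend-⊆ (inside  ∷ I) (_ ∷ J) here       = here
extend-⊆ (inside  ∷ I) (_ ∷ J) (there x∈) = there (extend-⊆ I J x∈)
extend-⊆ (outside ∷ I) J       (there x∈) = there (extend-⊆ I J x∈)

extend-nonempty : ∀ {n} (I : Subset n) {J} → Nonempty J → Nonempty (extend I J)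
extend-nonempty (inside  ∷ I) (zero  , here)     = zero , here
extend-nonempty (inside  ∷ I) {_ ∷ _} (suc j , there j∈) =
  let i , i∈ = extend-nonempty I (j , j∈) in suc i , there i∈
extend-nonempty (outside ∷ I) J≢∅ =
  let i , i∈ = extend-nonempty I J≢∅ in suc i , there i∈

extend-injective : ∀ {n} (I : Subset n) {J K} → extend I J ≡ extend I K → J ≡ K
extend-injective []            {[]}    {[]}    _  = refl
extend-injective (inside  ∷ I) {_ ∷ _} {_ ∷ _} eq =
  cong₂ _∷_ (Vec.∷-injectiveˡ eq) (extend-injective I (Vec.∷-injectiveʳ eq))
extend-injective (outside ∷ I) eq = extend-injective I (Vec.∷-injectiveʳ eq)

funToFin-cong : ∀ {m n} {f g : Fin m → Fin n} → (∀ i → f i ≡ g i) → funToFin f ≡ funToFin g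
funToFin-cong {zero}  _   = refl
funToFin-cong {suc m} f≗g = cong₂ Fin.combine (f≗g zero) (funToFin-cong (f≗g ∘ suc))

bit : Fin 2 → Bool
bit = Inverse.to Fin.2↔Bool

-- Base-2 digits are read as a characteristic vector, so that subsets can be counted by an injection
-- between `Fin` types.
decodeSubset : ∀ {n} → Fin (2 ℕ.^ n) → Subset n
decodeSubset i = Vec.tabulate (bit ∘ finToFun i)

decodeSubset-injective : ∀ {n} → Injective _≡_ _≡_ (decodeSubset {n})
decodeSubset-injective {n} {i} {j} eq = begin
  i                               ≡⟨ Fin.funToFin-finToFin {n} {2} i ⟨
  funToFin (finToFun {2} {n} i)   ≡⟨ funToFin-cong (λ x → Injection.injective (↔⇒↣ Fin.2↔Bool) (begin
    bit (finToFun i x)              ≡⟨ Vec.lookup∘tabulate _ x ⟨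
    lookup (decodeSubset i) x       ≡⟨ cong (λ J → lookup J x) eq ⟩
    lookup (decodeSubset j) x       ≡⟨ Vec.lookup∘tabulate _ x ⟩
    bit (finToFun j x)              ∎)) ⟩
  funToFin (finToFun {2} {n} j)   ≡⟨ Fin.funToFin-finToFin {n} {2} j ⟩
  j                               ∎
  where open ≡-Reasoning

─-empty⇒⊆ : ∀ {n} {I J : Subset n} → Empty (I ─ J) → I ⊆ J
─-empty⇒⊆ {J = J} I─J≡∅ {x} x∈I with x Subset.∈? J
... | yes x∈J = x∈J
... | no  x∉J = contradiction (x , Subset.x∈p∧x∉q⇒x∈p─q x∈I x∉J) I─J≡∅

-- Rational inequalities

0≤/ : ∀ a b .{{_ : NonZero b}} → 0ℚ ℚ.≤ + a / b
0≤/ a b = ℚ.nonNegative⁻¹ (+ a / b) {{ℚ.normalize-nonNeg a b}}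

-- Intended for reciprocals of orders and I the set of leading indices: each leading term is
-- estimated by w, while the others remain as the cross number of a submultiset.
sum-split : ∀ {n} w (f : Vector ℚ n) (I : Subset n) → (∀ i → f i ℚ.≤ w) →
            ℚSum.sum f ℚ.≤ (+ ∣ I ∣ˢ / 1) ℚ.* w ℚ.+ ℚSum.sum (f ∘ index (∁ I))
sum-split w f [] _ = ℚ.≤-reflexive (sym (trans (ℚ.+-identityʳ _) (ℚ.*-zeroˡ w)))
sum-split w f (inside ∷ I) f≤w = begin
  f zero ℚ.+ ℚSum.sum (f ∘ suc)            ≤⟨ ℚ.+-mono-≤ (f≤w zero) (sum-split w (f ∘ suc) I (f≤w ∘ suc)) ⟩
  w ℚ.+ ((+ ∣ I ∣ˢ / 1) ℚ.* w ℚ.+ rest)    ≡⟨ collect w (+ ∣ I ∣ˢ / 1) rest ⟩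
  (1ℚ ℚ.+ (+ ∣ I ∣ˢ / 1)) ℚ.* w ℚ.+ rest   ≡⟨ cong (λ v → v ℚ.* w ℚ.+ rest) (/-distribʳ-+ 1 ∣ I ∣ˢ 1) ⟨
  (+ suc ∣ I ∣ˢ / 1) ℚ.* w ℚ.+ rest        ∎
  where
  open ℚ.≤-Reasoning
  rest = ℚSum.sum (f ∘ suc ∘ index (∁ I))
  collect : ∀ w m r → w ℚ.+ (m ℚ.* w ℚ.+ r) ≡ (1ℚ ℚ.+ m) ℚ.* w ℚ.+ r
  collect = solve 3 (λ w m r → w :+ (m :* w :+ r) := (con 1ℚ :+ m) :* w :+ r) refl
    where open ℚSolver
sum-split w f (outside ∷ I) f≤w = begin
  f zero ℚ.+ ℚSum.sum (f ∘ suc)               ≤⟨ ℚ.+-monoʳ-≤ (f zero) (sum-split w (f ∘ suc) I (f≤w ∘ suc)) ⟩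
  f zero ℚ.+ (m ℚ.+ rest)                     ≡⟨ swap (f zero) m rest ⟩
  m ℚ.+ (f zero ℚ.+ rest)                     ∎
  where
  open ℚ.≤-Reasoning
  m = (+ ∣ I ∣ˢ / 1) ℚ.* w
  rest = ℚSum.sum (f ∘ suc ∘ index (∁ I))
  swap : ∀ a b c → a ℚ.+ (b ℚ.+ c) ≡ b ℚ.+ (a ℚ.+ c)
  swap = solve 3 (λ a b c → a :+ (b :+ c) := b :+ (a :+ c)) refl
    where open ℚSolver

/-mono-≤ : ∀ a b c d .{{_ : NonZero b}} .{{_ : NonZero d}} →
           a ℕ.* d ≤ c ℕ.* b → (+ a / b) ℚ.≤ (+ c / d)
/-mono-≤ a (suc b) c (suc d) ad≤cb = ℚ.toℚᵘ-cancel-≤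
  (ℚᵘ.≤-respˡ-≃ (ℚᵘ.≃-sym (ℚ.toℚᵘ-fromℚᵘ (ℚᵘ.mkℚᵘ (+ a) b)))
  (ℚᵘ.≤-respʳ-≃ (ℚᵘ.≃-sym (ℚ.toℚᵘ-fromℚᵘ (ℚᵘ.mkℚᵘ (+ c) d)))
  (ℚᵘ.*≤* (subst₂ ℤ._≤_ (ℤ.pos-* a (suc d)) (ℤ.pos-* c (suc b)) (ℤ.+≤+ ad≤cb)))))

/1-cancel-≤ : ∀ {a b} → (+ a / 1) ℚ.≤ (+ b / 1) → a ≤ b
/1-cancel-≤ {a} {b} a≤b = ℕ.≮⇒≥ λ b<a →
  ℚ.<-irrefl refl (ℚ.<-≤-trans (/-mono-< b 1 a 1 (ℕ.*-monoˡ-< 1 b<a)) a≤b)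

/-scale : ∀ a c d .{{_ : NonZero d}} → (+ a / 1) ℚ.* (+ c / d) ≡ + (a ℕ.* c) / d
/-scale a c (suc d) = ℚ.toℚᵘ-injective (begin
  ℚ.toℚᵘ ((+ a / 1) ℚ.* (+ c / suc d))           ≈⟨ ℚ.toℚᵘ-homo-* (+ a / 1) (+ c / suc d) ⟩
  ℚ.toℚᵘ (+ a / 1) ℚᵘ.* ℚ.toℚᵘ (+ c / suc d)
    ≈⟨ ℚᵘ.*-cong (ℚ.toℚᵘ-fromℚᵘ (ℚᵘ.mkℚᵘ (+ a) 0)) (ℚ.toℚᵘ-fromℚᵘ (ℚᵘ.mkℚᵘ (+ c) d)) ⟩
  ℚᵘ.mkℚᵘ (+ a) 0 ℚᵘ.* ℚᵘ.mkℚᵘ (+ c) d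
    ≈⟨ ℚᵘ.*≡* (cong₂ ℤ._*_ (sym (ℤ.pos-* a c)) (cong +_ (sym (ℕ.+-identityʳ (suc d))))) ⟩
  ℚᵘ.mkℚᵘ (+ (a ℕ.* c)) d                        ≈⟨ ℚ.toℚᵘ-fromℚᵘ (ℚᵘ.mkℚᵘ (+ (a ℕ.* c)) d) ⟨
  ℚ.toℚᵘ (+ (a ℕ.* c) / suc d)                   ∎)
  where open ℚᵘ.≃-Reasoning

positive-≤ℕ : ∀ p → .{{ℚ.Positive p}} → ∃ λ n → p ℚ.≤ + n / 1
positive-≤ℕ p@(ℚ.mkℚ (ℤ.+[1+ n ]) _ _) = suc n , subst (ℚ._≤ + suc n / 1) (ℚ.↥p/↧p≡p p)
  (/-mono-≤ (suc n) (ℚ.↧ₙ p) (suc n) 1 (ℕ.*-monoʳ-≤ (suc n) (s≤s ℕ.z≤n)))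

p≤∣p∣ : ∀ p → p ℚ.≤ ∣ p ∣
p≤∣p∣ p with ℚ.≤-total 0ℚ p
... | inj₁ 0≤p = ℚ.≤-reflexive (sym (ℚ.0≤p⇒∣p∣≡p 0≤p))
... | inj₂ p≤0 = ℚ.≤-trans p≤0 (ℚ.0≤∣p∣ p)

-- Zero-sum multisets

module CrossNumbers (G : FiniteAbelianGroup) where

  open FiniteAbelianGroup G using (enumeration) renaming (order to ∣G∣; abelianGroup to A)
  open ZeroSum G
  open AbelianGroup A
    renaming (_∙_ to _+_; ε to 0#; _⁻¹ to -_; ∙-cong to +-cong; ∙-congˡ to +-congˡ; ∙-congʳ to +-congʳ;
              assoc to +-assoc; identityˡ to +-identityˡ; identityʳ to +-identityʳ;
              refl to ≈-refl; sym to ≈-sym; trans to ≈-trans)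
    hiding (_-_)
  open Inverse enumeration using (to; from; from-cong; strictlyInverseˡ; strictlyInverseʳ)
  open Algebra.Properties.CommutativeMonoid.Sum commutativeMonoid
    using (sum-cong-≋; ∑-distrib-+; sum-permute; sum-replicate) renaming (sum to ∑)
  open Algebra.Properties.Group group using (identityʳ-unique; ⁻¹-involutive; ε⁻¹≈ε; ∙-cancelˡ)
  open Algebra.Properties.Monoid.Mult monoid using (×-homo-+; ×-congʳ; ×-assocˡ) renaming (_×_ to _·_)
  open Relation.Binary.Reasoning.Setoid setoid

  -- Orders of elements

  translation : Carrier → Permutation ∣G∣ ∣G∣
  translation g = permutation (λ i → from (to i + g)) (λ i → from (to i + (- g)))
    (λ i → roundTrip (- g) g i (inverseˡ g))
    (λ i → roundTrip g (- g) i (inverseʳ g))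
    where
    roundTrip : ∀ a b i → a + b ≈ 0# → from (to (from (to i + a)) + b) ≡ i
    roundTrip a b i a+b≈0 = trans (from-cong (begin
      to (from (to i + a)) + b ≈⟨ +-congʳ (strictlyInverseˡ (to i + a)) ⟩
      (to i + a) + b           ≈⟨ +-assoc (to i) a b ⟩
      to i + (a + b)           ≈⟨ +-congˡ a+b≈0 ⟩
      to i + 0#                ≈⟨ +-identityʳ (to i) ⟩
      to i                     ∎)) (strictlyInverseʳ i)

  -- Translation by g permutes G, so Σ (x + g) = Σ x over all x in G.
  order·g≈0 : ∀ g → ∣G∣ · g ≈ 0#
  order·g≈0 g = identityʳ-unique (∑ to) (∣G∣ · g) (begin
    ∑ to + ∣G∣ · g                     ≈⟨ +-congˡ (sum-replicate ∣G∣) ⟨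
    ∑ to + ∑ {∣G∣} (λ _ → g)           ≈⟨ ∑-distrib-+ to (λ _ → g) ⟨
    ∑ (λ i → to i + g)                 ≈⟨ sum-cong-≋ (λ i → strictlyInverseˡ (to i + g)) ⟨
    ∑ (λ i → to (from (to i + g)))     ≈⟨ sum-permute to (translation g) ⟨
    ∑ to                               ∎)

  n·0≈0 : ∀ n → n · 0# ≈ 0#
  n·0≈0 zero    = ≈-refl
  n·0≈0 (suc n) = ≈-trans (+-identityˡ _) (n·0≈0 n)

  ord·g≈0 : ∀ g → ord g · g ≈ 0#
  ord·g≈0 g = proj₁ (proj₂ (leastPeriod g))

  ord-minimal : ∀ g r → r ℕ.< ord g → r · g ≈ 0# → r ≡ 0
  ord-minimal g zero    _         _     = refl
  ord-minimal g (suc r) (s≤s r<m) rg≈0 = contradiction rg≈0 (proj₂ (proj₂ (leastPeriod g)) r r<m)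

  -- The remainder of n modulo `ord g` annihilates g too and is smaller than `ord g`, hence 0.
  ord∣ : ∀ g n → n · g ≈ 0# → ord g ∣ n
  ord∣ g n ng≈0 = m%n≡0⇒n∣m n (ord g) (ord-minimal g r (m%n<n n (ord g)) (begin
    r · g                       ≈⟨ +-identityʳ _ ⟨
    r · g + 0#                  ≈⟨ +-congˡ (n·0≈0 q) ⟨
    r · g + q · 0#              ≈⟨ +-congˡ (×-congʳ q (ord·g≈0 g)) ⟨
    r · g + q · (ord g · g)     ≈⟨ +-congˡ (×-assocˡ g q (ord g)) ⟩
    r · g + (q ℕ.* ord g) · g   ≈⟨ ×-homo-+ g r (q ℕ.* ord g) ⟨
    (r ℕ.+ q ℕ.* ord g) · g     ≡⟨ cong (_· g) (m≡m%n+[m/n]*n n (ord g)) ⟨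
    n · g                       ≈⟨ ng≈0 ⟩
    0#                          ∎))
    where
    r = n % ord g
    q = n ℕ./ ord g

  ord∣order : ∀ g → ord g ∣ ∣G∣
  ord∣order g = ord∣ g ∣G∣ (order·g≈0 g)

  ord-nonTrivial : ∀ g → ¬ g ≈ 0# → NonTrivial (ord g)
  ord-nonTrivial g g≉0 = ℕ.n>1⇒nonTrivial (ℕ.≤∧≢⇒< (s≤s ℕ.z≤n) λ 1≡ord →
    g≉0 (≈-trans (≈-sym (+-identityʳ g)) (subst (λ n → n · g ≈ 0#) (sym 1≡ord) (ord·g≈0 g))))

  -- Submultisets and leading indices

  σ-restrict : ∀ {ℓ} (S : Vector Carrier ℓ) I J → σ (S ∘ index I) J ≈ σ S (extend I J)
  σ-restrict S []            []      = ≈-refl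
  σ-restrict S (inside  ∷ I) (b ∷ J) = +-congˡ (σ-restrict (S ∘ suc) I J)
  σ-restrict S (outside ∷ I) J       = ≈-trans (σ-restrict (S ∘ suc) I J) (≈-sym (+-identityˡ _))

  restrict-free : ∀ {ℓ} (S : Vector Carrier ℓ) I →
                  (∀ J → Nonempty J → J ⊆ I → ¬ σ S J ≈ 0#) → IsZeroSumFree (S ∘ index I)
  restrict-free S I free J J≢∅ σ≈0 =
    free (extend I J) (extend-nonempty I J≢∅) (extend-⊆ I J) (≈-trans (≈-sym (σ-restrict S I J)) σ≈0)

  module Leading {ℓ} (S : Vector Carrier ℓ) (S≢0 : Nonzero S) (σ≈0 : IsZeroSum S)
                 (same : BlocksDisjoint S) where

    -- `R` asks an index to come first in every block containing it. Since `σ≈0` puts each index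
    -- into some block, these are exactly the first elements of the blocks.
    L : Subset ℓ
    L = R S S≢0 same

    leading : ∀ {i} → i ∈ L → ∀ B → Block S B → i ∈ B → ∀ j → j ∈ B → i Fin.≤ j
    leading = ∈⟦⟧⁻ (leads? S S≢0 same)

    leading-unique : ∀ {B i j} → Block S B → i ∈ L → i ∈ B → j ∈ L → j ∈ B → i ≡ j
    leading-unique {B} {i} {j} block i∈L i∈B j∈L j∈B =
      Fin.≤-antisym (leading i∈L B block i∈B j j∈B) (leading j∈L B block j∈B i i∈B)

    -- By `same`, every block through the minimum of B is B itself, so this minimum leads.
    leader : ∀ B → Block S B → ∃ λ i → i ∈ B × i ∈ L
    leader B block@(B≢∅ , _) with minimum B B≢∅
    ... | i , i∈B , below = i , i∈B , ∈⟦⟧⁺ (leads? S S≢0 same) λ C C-block i∈C j j∈C →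
      below (subst (j ∈_) (same C B C-block block (i , Subset.x∈p∩q⁺ (i∈C , i∈B))) j∈C)

    blockThrough : ∀ V → σ S V ≈ 0# → ∀ {i} → i ∈ V → ∃ λ B → B ⊆ V × Block S B × i ∈ B
    blockThrough V σV≈0 {i} i∈V =
      let Bs , isBlock , _ , within , cover = factor S V σV≈0
          B , B∈Bs , i∈B = List∈.find (cover i i∈V)
      in B , All.lookup within B∈Bs , All.lookup isBlock B∈Bs , i∈B

    -- Blocks through elements of A are removed from V one by one until the rest W misses A. A block
    -- contains only one leading index, and that of a removed block lies in A, so the leading
    -- indices outside A survive.
    removeBlocks : ∀ V → σ S V ≈ 0# → ∀ A → A ⊆ L →
                   ∃ λ W → σ S W ≈ 0# × Empty (W ∩ A) × (V ∩ L) ─ A ⊆ W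
    removeBlocks V = go V (⊂-wellFounded V)
      where
      go : ∀ V → Acc _⊂_ V → σ S V ≈ 0# → ∀ A → A ⊆ L →
           ∃ λ W → σ S W ≈ 0# × Empty (W ∩ A) × (V ∩ L) ─ A ⊆ W
      go V (acc rec) σV≈0 A A⊆L with Subset.nonempty? (V ∩ A)
      ... | no  V∩A≡∅ = V , σV≈0 , V∩A≡∅ , Subset.p∩q⊆p V L ∘ Subset.p─q⊆p (V ∩ L) A
      ... | yes (a , a∈V∩A) with Subset.x∈p∩q⁻ V A a∈V∩A
      ...   | a∈V , a∈A with blockThrough V σV≈0 a∈V
      ...     | B , B⊆V , block , a∈B
        with go (V ─ B) (rec (Subset.p∩q≢∅⇒p─q⊂p V B (a , Subset.x∈p∩q⁺ (a∈V , a∈B))))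
                (σ-─≈0 S V B B⊆V (≈-trans σV≈0 (≈-sym (proj₁ (proj₂ block))))) A A⊆L
      ...       | W , σW≈0 , W∩A≡∅ , keeps = W , σW≈0 , W∩A≡∅ , λ {x} x∈ →
        let x∈V∩L = Subset.p─q⊆p (V ∩ L) A x∈
            x∉A = ∉─ (V ∩ L) A x∈
            x∈V , x∈L = Subset.x∈p∩q⁻ V L x∈V∩L
            x∉B = λ x∈B → x∉A (subst (_∈ A) (leading-unique block (A⊆L a∈A) a∈B x∈L x∈B) a∈A)
        in keeps (Subset.x∈p∧x∉q⇒x∈p─q
             (Subset.x∈p∩q⁺ (Subset.x∈p∧x∉q⇒x∈p─q x∈V x∉B , x∈L)) x∉A)

    -- Let U be the union of the blocks meeting J and W the union of the others.
    -- If σ I = σ J then (U ∪ I) ─ J is zero-sum, and a block in it would lie in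
    -- W and hence in I, which is zero-sum free.
    disjointSums : ∀ I J → I ⊆ L → J ⊆ L → Disjoint I J → σ S I ≈ σ S J → Empty I × Empty J
    disjointSums I J I⊆L J⊆L I∩J≡∅ σI≈σJ
      with removeBlocks ⊤ σ≈0 J J⊆L
    ... | W , σW≈0 , W∩J≡∅ , keeps = I≡∅ , J≡∅
      where
      U = ⊤ ─ W
      X = (U ∪ I) ─ J

      U∩W : ∀ {x} → x ∈ U → x ∉ W
      U∩W = ∉─ ⊤ W

      J⊆U : J ⊆ U
      J⊆U x∈J = Subset.x∈p∧x∉q⇒x∈p─q Subset.∈⊤ λ x∈W → W∩J≡∅ (_ , Subset.x∈p∩q⁺ (x∈W , x∈J))

      L─J⊆W : ∀ {x} → x ∈ L → x ∉ J → x ∈ W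
      L─J⊆W x∈L x∉J = keeps (Subset.x∈p∧x∉q⇒x∈p─q (Subset.x∈p∩q⁺ (Subset.∈⊤ , x∈L)) x∉J)

      I⊆W : I ⊆ W
      I⊆W x∈I = L─J⊆W (I⊆L x∈I) λ x∈J → I∩J≡∅ (_ , Subset.x∈p∩q⁺ (x∈I , x∈J))

      -- I lies in W and so is disjoint from U; hence adjoining I to U adds exactly σ(I).
      U∪I─U≡I : (U ∪ I) ─ U ≡ I
      U∪I─U≡I = Subset.⊆-antisym
        (λ x∈ → case⊎ (Subset.x∈p∪q⁻ U I (Subset.p─q⊆p (U ∪ I) U x∈)) (∉─ (U ∪ I) U x∈))
        (λ x∈I → Subset.x∈p∧x∉q⇒x∈p─q (Subset.q⊆p∪q U I x∈I) λ x∈U → U∩W x∈U (I⊆W x∈I))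
        where
        case⊎ : ∀ {x} → x ∈ U ⊎ x ∈ I → x ∉ U → x ∈ I
        case⊎ (inj₁ x∈U) x∉U = contradiction x∈U x∉U
        case⊎ (inj₂ x∈I) _   = x∈I

      σU≈0 : σ S U ≈ 0#
      σU≈0 = σ-─≈0 S ⊤ W Subset.⊆⊤ (≈-trans σ≈0 (≈-sym σW≈0))

      σX≈0 : σ S X ≈ 0#
      σX≈0 = σ-─≈0 S (U ∪ I) J (Subset.p⊆p∪q I ∘ J⊆U) (begin
        σ S (U ∪ I)               ≈⟨ σ-─ S (U ∪ I) U (Subset.p⊆p∪q I) ⟩
        σ S U + σ S ((U ∪ I) ─ U) ≈⟨ +-congʳ σU≈0 ⟩
        0# + σ S ((U ∪ I) ─ U)    ≈⟨ +-identityˡ _ ⟩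
        σ S ((U ∪ I) ─ U)         ≡⟨ cong (σ S) U∪I─U≡I ⟩
        σ S I                     ≈⟨ σI≈σJ ⟩
        σ S J                     ∎)

      W∩X⊆I : ∀ {x} → x ∈ W → x ∈ X → x ∈ I
      W∩X⊆I x∈W x∈X with Subset.x∈p∪q⁻ U I (Subset.p─q⊆p (U ∪ I) J x∈X)
      ... | inj₁ x∈U = contradiction x∈W (U∩W x∈U)
      ... | inj₂ x∈I = x∈I

      noBlock : ∀ B → B ⊆ X → ¬ Block S B
      -- The leader b of B is not in J, hence lies in W. The block inside W through b is B by
      -- `same`, so B is contained in both W and X, thus in I and in L, contradicting `R-free`.
      noBlock B B⊆X block with leader B block
      ... | b , b∈B , b∈L with blockThrough W σW≈0 (L─J⊆W b∈L (∉─ (U ∪ I) J (B⊆X b∈B)))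
      ...   | C , C⊆W , C-block , b∈C =
        R-free S S≢0 same B (b , b∈B) B⊆L (proj₁ (proj₂ block))
        where
        B⊆L : B ⊆ L
        B⊆L x∈B = I⊆L (W∩X⊆I
          (C⊆W (subst (_ ∈_) (same B C block C-block (b , Subset.x∈p∩q⁺ (b∈B , b∈C))) x∈B)) (B⊆X x∈B))

      X≡∅ : Empty X
      X≡∅ X≢∅ with minimalBlock S X X≢∅ σX≈0
      ... | B , B⊆X , block = noBlock B B⊆X block

      I≡∅ : Empty I
      I≡∅ (x , x∈I) = X≡∅ (x , Subset.x∈p∧x∉q⇒x∈p─q (Subset.q⊆p∪q U I x∈I)
        λ x∈J → I∩J≡∅ (x , Subset.x∈p∩q⁺ (x∈I , x∈J)))

      J≡∅ : Empty J
      -- As X is empty, U is contained in J and so in L. If J had an element, U would be a nonempty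
      -- zero-sum part of L.
      J≡∅ (x , x∈J) = R-free S S≢0 same U (x , J⊆U x∈J)
        (J⊆L ∘ ─-empty⇒⊆ λ (y , y∈U─J) → X≡∅ (y , Subset.x∈p∧x∉q⇒x∈p─q
          (Subset.p⊆p∪q I (Subset.p─q⊆p U J y∈U─J)) (∉─ U J y∈U─J))) σU≈0

    -- Cancelling the common part reduces the claim to the disjoint sets J ─ I and I ─ J. They are
    -- written as `K ─ I` and `K ─ J` with K = I ∪ J, so that both sums come from splitting σ(K).
    σ-injective : ∀ {I J} → I ⊆ L → J ⊆ L → σ S I ≈ σ S J → I ≡ J
    σ-injective {I} {J} I⊆L J⊆L σI≈σJ =
      let J─I≡∅ , I─J≡∅ = disjointSums (K ─ I) (K ─ J)
            (within J⊆L I⊆L) (within J⊆L I⊆L) disjoint-complements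
            (∙-cancelˡ (σ S I) _ _ (begin
              σ S I + σ S (K ─ I)  ≈⟨ σ-─ S K I I⊆K ⟨
              σ S K                ≈⟨ σ-─ S K J J⊆K ⟩
              σ S J + σ S (K ─ J)  ≈⟨ +-congʳ σI≈σJ ⟨
              σ S I + σ S (K ─ J)  ∎))
      in Subset.⊆-antisym (─-empty⇒⊆ I─J≡∅ ∘ I⊆K) (─-empty⇒⊆ J─I≡∅ ∘ J⊆K)
      where
      K = I ∪ J
      I⊆K : I ⊆ K
      I⊆K = Subset.p⊆p∪q J
      J⊆K : J ⊆ K
      J⊆K = Subset.q⊆p∪q I J
      within : ∀ {M} → J ⊆ L → I ⊆ L → K ─ M ⊆ L
      within {M} J⊆L I⊆L x∈ with Subset.x∈p∪q⁻ I J (Subset.p─q⊆p K M x∈)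
      ... | inj₁ x∈I = I⊆L x∈I
      ... | inj₂ x∈J = J⊆L x∈J
      disjoint-complements : Disjoint (K ─ I) (K ─ J)
      disjoint-complements (x , x∈) with Subset.x∈p∩q⁻ (K ─ I) (K ─ J) x∈
      ... | x∈K─I , x∈K─J with Subset.x∈p∪q⁻ I J (Subset.p─q⊆p K I x∈K─I)
      ...   | inj₁ x∈I = ∉─ K I x∈K─I x∈I
      ...   | inj₂ x∈J = ∉─ K J x∈K─J x∈J

    -- The subset sums of L are pairwise distinct elements of G.
    2^∣L∣≤order : 2 ℕ.^ ∣ L ∣ˢ ℕ.≤ ∣G∣
    2^∣L∣≤order = Fin.injective⇒≤ {f = λ i → from (σ S (extend L (decodeSubset i)))} λ {i} {j} eq →
      decodeSubset-injective (extend-injective L (σ-injective (extend-⊆ L _) (extend-⊆ L _) (begin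
        σ S (extend L (decodeSubset i))             ≈⟨ strictlyInverseˡ _ ⟨
        to (from (σ S (extend L (decodeSubset i)))) ≡⟨ cong to eq ⟩
        to (from (σ S (extend L (decodeSubset j)))) ≈⟨ strictlyInverseˡ _ ⟩
        σ S (extend L (decodeSubset j))             ∎)))

  -- For a UFIM attaining K₁(G) and m = |L|, the leading terms cost at most w each. The remaining
  -- indices contain no whole block, hence form a zero-sum free multiset of cross number at most
  -- k(G).
  K₁≤k+ : ∀ w → (∀ g → ¬ g ≈ 0# → (+ 1 / ord g) ℚ.≤ w) →
          ∃ λ m → 2 ℕ.^ m ℕ.≤ ∣G∣ × K₁ G ℚ.≤ (+ m / 1) ℚ.* w ℚ.+ k G
  K₁≤k+ w 1/ord≤w with proj₂ K₁-exists
  ... | (ℓ , S , ufim , kS≡K₁) , _ with Equivalence.to (isUFIM⇔ S) ufim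
  ...   | S≢0 , σ≈0 , same = ∣ L ∣ˢ , 2^∣L∣≤order ,
    ℚ.≤-trans (ℚ.≤-reflexive (sym kS≡K₁))
      (ℚ.≤-trans (sum-split w _ L λ i → 1/ord≤w (S i) (S≢0 i))
        (ℚ.+-monoʳ-≤ ((+ ∣ L ∣ˢ / 1) ℚ.* w)
          (proj₂ (proj₂ k-exists) (S ∘ index (∁ L))
            ((λ i → S≢0 (index (∁ L) i)) , restrict-free S (∁ L) (∁R-free S S≢0 same)))))
    where open Leading S S≢0 σ≈0 same

  ⊤-nonempty : ∀ {ℓ} → Nonempty (⊤ {suc ℓ})
  ⊤-nonempty = zero , here

  -- Appending -σ(S) to a nonempty zero-sum free S gives a minimal zero-sum
  -- multiset, whose only block is everything.
  complete-ufim : ∀ {ℓ} (S : Vector Carrier (suc ℓ)) → Nonzero S → IsZeroSumFree S →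
                  IsUFIM ((- σ S ⊤) Vector.∷ S)
  complete-ufim S S≢0 free = Equivalence.from (isUFIM⇔ S⁺)
    ( (λ { zero    → λ -σ≈0 → free ⊤ ⊤-nonempty (≈-trans (≈-sym (⁻¹-involutive _)) (≈-trans (⁻¹-cong -σ≈0) ε⁻¹≈ε))
         ; (suc i) → S≢0 i })
    , inverseˡ (σ S ⊤)
    , λ I J I-block J-block _ → trans (everything I I-block) (sym (everything J J-block)) )
    where
    S⁺ = (- σ S ⊤) Vector.∷ S
    everything : ∀ I → Block S⁺ I → I ≡ ⊤
    -- A block avoiding the appended element would be a zero-sum part of S.
    everything (outside ∷ J) ((suc i , there i∈J) , σ≈0 , _) =
      contradiction (≈-trans (≈-sym (+-identityˡ _)) σ≈0) (free J (i , i∈J))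
    -- Here σ(J) = σ(S), so the part of S outside J has sum 0 and must be empty.
    everything (inside ∷ J) (_ , σ≈0 , _) = cong (inside ∷_)
      (Subset.⊆-antisym Subset.⊆⊤ (─-empty⇒⊆ λ ⊤─J≢∅ → free (⊤ ─ J) ⊤─J≢∅
        (σ-─≈0 S ⊤ J Subset.⊆⊤ (∙-cancelˡ (- σ S ⊤) _ _ (≈-trans (inverseˡ _) (≈-sym σ≈0))))))

  k≤K₁ : k G ℚ.≤ K₁ G
  k≤K₁ with proj₂ k-exists
  -- The empty multiset is a UFIM as it stands; the element -σ(S) = 0 could not be appended to it.
  ... | (zero , S , _ , kS≡k) , _ = ℚ.≤-trans (ℚ.≤-reflexive (sym kS≡k))
    (proj₂ (proj₂ K₁-exists) S (Equivalence.from (isUFIM⇔ S) ((λ ()) , ≈-refl , λ { [] [] _ _ _ → refl })))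
  ... | (suc ℓ , S , (S≢0 , free) , kS≡k) , _ = ℚ.≤-trans (ℚ.≤-reflexive (sym kS≡k))
    (ℚ.≤-trans (ℚ.≤-trans (ℚ.≤-reflexive (sym (ℚ.+-identityˡ _)))
      (ℚ.+-monoˡ-≤ (crossNumber S) (0≤/ 1 (ord (- σ S ⊤)))))
      (proj₂ (proj₂ K₁-exists) ((- σ S ⊤) Vector.∷ S) (complete-ufim S S≢0 free)))

-- Orders and prime divisors

-- A group has size n when injections exist in both directions; no injection
-- out of the group is required to respect ≈, which makes products immediate.
record HasSize (A : AbelianGroup 0ℓ 0ℓ) (n : ℕ) : Set where
  open AbelianGroup A using (Carrier; _≈_)
  field
    element           : Fin n → Carrier
    element-injective : ∀ {i j} → element i ≈ element j → i ≡ j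
    code              : Carrier → Fin n
    code-injective    : ∀ {x y} → code x ≡ code y → x ≈ y

open HasSize

⨁-[]-size : HasSize (⨁ []) 1
⨁-[]-size = record
  { element           = _
  ; element-injective = λ { {zero} {zero} _ → refl }
  ; code              = λ _ → zero
  ; code-injective    = _
  }

⨁-∷-size : ∀ A As {m n} → HasSize A m → HasSize (⨁ As) n → HasSize (⨁ (A ∷ As)) (m ℕ.* n)
⨁-∷-size A As {m} {n} a b = record
  { element           = λ i → element a (proj₁ (Fin.remQuot {m} n i)) , element b (proj₂ (Fin.remQuot {m} n i))
  ; element-injective = λ {i} {j} (eq₁ , eq₂) → trans (sym (Fin.combine-remQuot {m} n i))
      (trans (cong₂ Fin.combine (element-injective a eq₁) (element-injective b eq₂)) (Fin.combine-remQuot {m} n j))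
  ; code              = λ (x , y) → Fin.combine (code a x) (code b y)
  ; code-injective    = λ eq →
      let eq₁ , eq₂ = Fin.combine-injective _ _ _ _ eq in code-injective a eq₁ , code-injective b eq₂
  }

-- The difference b - a is a multiple of n smaller than n, hence 0.
∣-∣<⇒≡ : ∀ {n} a b → a ℕ.≤ b → b ℕ.< n → + n ℤ.∣ + a ℤ.- + b → a ≡ b
∣-∣<⇒≡ {n} a b a≤b b<n n∣a-b with b ℕ.∸ a in b∸a≡
... | zero  = ℕ.≤-antisym a≤b (ℕ.m∸n≡0⇒m≤n b∸a≡)
... | suc d = contradiction n∣1+d (>⇒∤ (ℕ.≤-<-trans (subst (ℕ._≤ b) b∸a≡ (ℕ.m∸n≤m b a)) b<n))
  where
  n∣1+d : n ∣ suc d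
  n∣1+d = subst (n ∣_) (trans (cong ℤ.∣_∣ (trans (ℤ.m-n≡m⊖n a b) (ℤ.⊖-≤ a≤b)))
            (trans (ℤ.∣-i∣≡∣i∣ (+ (b ℕ.∸ a))) b∸a≡)) (ℤ.∣⇒∣ᵤ n∣a-b)

ℤ/-size : ∀ n .{{_ : NonZero n}} → HasSize (ℤ/ n) n
ℤ/-size n = record
  { element           = +_ ∘ toℕ
  ; element-injective = λ {i} {j} n∣i-j → Fin.toℕ-injective (sameResidue i j n∣i-j)
  ; code              = λ x → Fin.fromℕ< (ℤ.n%ℕd<d x n)
  ; code-injective    = λ {x} {y} eq → ℤ.divides (x ℤ./ℕ n ℤ.- y ℤ./ℕ n)
      (trans (cong₂ ℤ._-_ (ℤ.a≡a%ℕn+[a/ℕn]*n x n)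
                (trans (ℤ.a≡a%ℕn+[a/ℕn]*n y n)
                   (cong (λ r → + r ℤ.+ y ℤ./ℕ n ℤ.* + n) (sym (Fin.fromℕ<-injective _ _ _ _ eq)))))
         (cancel (+ (x ℤ.%ℕ n)) (x ℤ./ℕ n) (y ℤ./ℕ n) (+ n)))
  }
  where
  sameResidue : ∀ (i j : Fin n) → + n ℤ.∣ + toℕ i ℤ.- + toℕ j → toℕ i ≡ toℕ j
  sameResidue i j n∣i-j with ℕ.≤-total (toℕ i) (toℕ j)
  ... | inj₁ i≤j = ∣-∣<⇒≡ (toℕ i) (toℕ j) i≤j (Fin.toℕ<n j) n∣i-j
  ... | inj₂ j≤i = sym (∣-∣<⇒≡ (toℕ j) (toℕ i) j≤i (Fin.toℕ<n i)
          (AbelianGroup.sym (ℤ/ n) {+ toℕ i} {+ toℕ j} n∣i-j))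
  cancel : ∀ r p q n → (r ℤ.+ p ℤ.* n) ℤ.- (r ℤ.+ q ℤ.* n) ≡ (p ℤ.- q) ℤ.* n
  cancel = solve 4 (λ r p q n → (r :+ p :* n) :- (r :+ q :* n) := (p :- q) :* n) refl
    where open ℤSolver

-- Agrees definitionally with the summands in the field `decomposition` of `𝒮`.
component : ℕ × List ℕ → AbelianGroup 0ℓ 0ℓ
component (p , es) = ⨁ (List.map (λ e → ℤ/ (p ℕ.^ e)) es)

componentOrder : ℕ × List ℕ → ℕ
componentOrder (p , es) = p ℕ.^ sum es

primary-size : ∀ p .{{_ : NonZero p}} es → HasSize (component (p , es)) (componentOrder (p , es))
primary-size p []       = ⨁-[]-size
primary-size p (e ∷ es) = subst (HasSize _) (sym (ℕ.^-distribˡ-+-* p e (sum es)))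
  (⨁-∷-size (ℤ/ (p ℕ.^ e)) (List.map (λ e → ℤ/ (p ℕ.^ e)) es)
    (ℤ/-size (p ℕ.^ e) {{ℕ.m^n≢0 p e}}) (primary-size p es))

decomposition-size : ∀ components → All (Prime ∘ proj₁) components →
  HasSize (⨁ (List.map component components)) (product (List.map componentOrder components))
decomposition-size []                []          = ⨁-[]-size
decomposition-size ((p , es) ∷ cs) (p-prime ∷ ps) =
  ⨁-∷-size (component (p , es)) (List.map component cs)
    (primary-size p {{prime⇒nonZero p-prime}} es) (decomposition-size cs ps)

-- Injections in both directions force equal sizes. The one into G uses a section ψ of φ supplied by
-- surjectivity; ψ may fail to respect `≈`, but φ undoes it.
order≡size : ∀ G {B n} → abelianGroup G ≅ B → HasSize B n → order G ≡ n
order≡size G {B} (φ , iso) b = ℕ.≤-antisym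
  (Fin.injective⇒≤ {f = code b ∘ φ ∘ to} λ eq →
    injectiveTo (injective (code-injective b eq)))
  (Fin.injective⇒≤ {f = from ∘ ψ ∘ element b} λ {i} {j} eq →
    element-injective b (B.trans (B.sym (φψ≈ (element b i)))
      (B.trans (⟦⟧-cong (injectiveFrom eq)) (φψ≈ (element b j)))))
  where
  open FiniteAbelianGroup G using (enumeration)
  open Inverse enumeration using (to; from; from-cong; strictlyInverseˡ; strictlyInverseʳ)
  open IsGroupIsomorphism iso using (⟦⟧-cong; injective; surjective)
  module A = AbelianGroup (abelianGroup G)
  module B = AbelianGroup B
  injectiveTo : ∀ {i j} → to i A.≈ to j → i ≡ j
  injectiveTo {i} {j} eq = trans (sym (strictlyInverseʳ i)) (trans (from-cong eq) (strictlyInverseʳ j))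
  injectiveFrom : ∀ {x y} → from x ≡ from y → x A.≈ y
  injectiveFrom {x} {y} eq = A.trans (A.sym (strictlyInverseˡ x))
    (A.trans (A.reflexive (cong to eq)) (strictlyInverseˡ y))
  ψ : B.Carrier → A.Carrier
  ψ y = proj₁ (surjective y)
  φψ≈ : ∀ y → φ (ψ y) B.≈ y
  φψ≈ y = proj₂ (surjective y) A.refl

order-nonZero : ∀ G → NonZero (order G)
order-nonZero G = nonZero (Inverse.from (FiniteAbelianGroup.enumeration G) (AbelianGroup.ε (abelianGroup G)))
  where
  nonZero : ∀ {n} → Fin n → NonZero n
  nonZero {suc _} _ = _

-- Smallest and largest prime divisors

∈-primeDivisors : ∀ {p M} .{{_ : NonZero M}} → Prime p → p ∣ M → p List∈.∈ primeDivisors M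
∈-primeDivisors {p} {M} p-prime p∣M = List∈.∈-filter⁺ (λ q → prime? q ×-dec q ∣? M)
  (List∈.∈-upTo⁺ (s≤s (∣⇒≤ p∣M))) (p-prime , p∣M)

P⁻≤prime : ∀ {p M} .{{_ : NonZero M}} → Prime p → p ∣ M → P⁻ M ≤ p
P⁻≤prime {M = M} p-prime p∣M = All.lookup (min≤xs (suc M) (primeDivisors M)) (∈-primeDivisors p-prime p∣M)

prime≤P⁺ : ∀ {p M} .{{_ : NonZero M}} → Prime p → p ∣ M → p ≤ P⁺ M
prime≤P⁺ {M = M} p-prime p∣M = All.lookup (xs≤max 1 (primeDivisors M)) (∈-primeDivisors p-prime p∣M)

∃-primeDivisor : ∀ n .{{_ : NonTrivial n}} → ∃ λ p → Prime p × p ∣ n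
∃-primeDivisor n = divisor (factorise n {{ℕ.nonTrivial⇒nonZero n}})
  where
  divisor : PrimeFactorisation n → ∃ λ p → Prime p × p ∣ n
  divisor record { factors = [] ; isFactorisation = n≡1 } = contradiction n≡1 ℕ.nonTrivial⇒≢1
  divisor record { factors = p ∷ ps ; isFactorisation = n≡ ; factorsPrime = p-prime ∷ _ } =
    p , p-prime , subst (p ∣_) (sym n≡) (m∣m*n (product ps))

-- A prime divisor of n also divides M. For n = ord(g) and M = |G| this yields 1 / ord(g) ≤ 1 /
-- P⁻(|G|).
P⁻≤divisor : ∀ {n M} .{{_ : NonTrivial n}} .{{_ : NonZero M}} → n ∣ M → P⁻ M ≤ n
P⁻≤divisor {n} n∣M = let p , p-prime , p∣n = ∃-primeDivisor n in
  ℕ.≤-trans (P⁻≤prime p-prime (∣-trans p∣n n∣M)) (∣⇒≤ {{ℕ.nonTrivial⇒nonZero n}} p∣n)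

product-^-bound : ∀ b cs → All (λ (p , es) → p ℕ.^ sum es ≤ b ℕ.^ sum es) cs →
                  product (List.map componentOrder cs) ≤ b ℕ.^ sum (List.map (sum ∘ proj₂) cs)
product-^-bound b []              []       = ℕ.≤-refl
product-^-bound b ((p , es) ∷ cs) (≤b ∷ bs) = ℕ.≤-trans (ℕ.*-mono-≤ ≤b (product-^-bound b cs bs))
  (ℕ.≤-reflexive (sym (ℕ.^-distribˡ-+-* b (sum es) _)))

module _ {N} (G : FiniteAbelianGroup) (G∈𝒮 : 𝒮 N G) where

  open 𝒮 G∈𝒮

  -- The number of prime factors of |G| counted with multiplicity, read off from the decomposition.
  ν : ℕ
  ν = sum (List.map (sum ∘ proj₂) components)

  order≡ : order G ≡ product (List.map componentOrder components)
  order≡ = order≡size G decomposition (decomposition-size components prime)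

  order≤P⁺^ν : order G ≤ P⁺ (order G) ℕ.^ ν
  order≤P⁺^ν = ℕ.≤-trans (ℕ.≤-reflexive order≡) (product-^-bound (P⁺ (order G)) components
    (All.tabulate λ {(p , es)} c∈ → bound p (sum es) (All.lookup prime c∈)
      (∈⇒∣product (List∈.∈-map⁺ componentOrder c∈))))
    where
    bound : ∀ p e → Prime p → p ℕ.^ e ∣ product (List.map componentOrder components) →
            p ℕ.^ e ≤ P⁺ (order G) ℕ.^ e
    -- A component without exponents contributes the factor 1, and its prime need not divide |G|.
    bound p zero    _       _   = ℕ.≤-refl
    bound p (suc e) p-prime p^e∣ = ℕ.^-monoˡ-≤ (suc e)
      (prime≤P⁺ {{order-nonZero G}} p-prime (subst (p ∣_) (sym order≡) (∣-trans (m∣m*n (p ℕ.^ e)) p^e∣)))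

-- Real bounds

pointwise⇒≤ᴿ : ∀ x y → (∀ n → seq x n ℚ.≤ seq y n) → x ≤ᴿ y
pointwise⇒≤ᴿ x y x≤y ε 0<ε = 0 , λ n _ → ℚ.≤-trans (x≤y n)
  (ℚ.≤-trans (ℚ.≤-reflexive (sym (ℚ.+-identityʳ (seq y n)))) (ℚ.+-monoʳ-≤ (seq y n) (ℚ.<⇒≤ 0<ε)))

≤ᴿ-trans : ∀ x y z → x ≤ᴿ y → y ≤ᴿ z → x ≤ᴿ z
≤ᴿ-trans x y z x≤y y≤z ε 0<ε =
  let δ , 0<δ , δ*2≡ε = quotient ε (+ 2 / 1) 0<ε (ℚ.positive⁻¹ (+ 2 / 1))
      M₁ , x≤ = x≤y δ 0<δ
      M₂ , y≤ = y≤z δ 0<δ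
  in M₁ ℕ.⊔ M₂ , λ n M≤n → begin
    seq x n                     ≤⟨ x≤ n (ℕ.m⊔n≤o⇒m≤o M₁ M₂ M≤n) ⟩
    seq y n ℚ.+ δ               ≤⟨ ℚ.+-monoˡ-≤ δ (y≤ n (ℕ.m⊔n≤o⇒n≤o M₁ M₂ M≤n)) ⟩
    seq z n ℚ.+ δ ℚ.+ δ         ≡⟨ double (seq z n) δ ⟩
    seq z n ℚ.+ δ ℚ.* (+ 2 / 1) ≡⟨ cong (seq z n ℚ.+_) δ*2≡ε ⟩
    seq z n ℚ.+ ε               ∎
  where
  open ℚ.≤-Reasoning
  double : ∀ p q → p ℚ.+ q ℚ.+ q ≡ p ℚ.+ q ℚ.* (+ 2 / 1)
  double = solve 2 (λ p q → p :+ q :+ q := p :+ q :* con (+ 2 / 1)) refl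
    where open ℚSolver

*ᴿ-monoˡ-≤ᴿ : ∀ x y z → (∀ n → 0ℚ ℚ.≤ seq z n) → x ≤ᴿ y → x *ᴿ z ≤ᴿ y *ᴿ z
*ᴿ-monoˡ-≤ᴿ x y z 0≤z x≤y ε 0<ε =
  let B , 0<B , M₁ , bound = eventuallyBounded z
      δ , 0<δ , δB≡ε = quotient ε B 0<ε 0<B
      M₂ , x≤ = x≤y δ 0<δ
  in M₁ ℕ.⊔ M₂ , λ n M≤n → begin
    seq x n ℚ.* seq z n
      ≤⟨ ℚ.*-monoʳ-≤-nonNeg (seq z n) {{ℚ.nonNegative (0≤z n)}} (x≤ n (ℕ.m⊔n≤o⇒n≤o M₁ M₂ M≤n)) ⟩
    (seq y n ℚ.+ δ) ℚ.* seq z n               ≡⟨ ℚ.*-distribʳ-+ (seq z n) (seq y n) δ ⟩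
    seq y n ℚ.* seq z n ℚ.+ δ ℚ.* seq z n
      ≤⟨ ℚ.+-monoʳ-≤ (seq y n ℚ.* seq z n) (ℚ.*-monoˡ-≤-nonNeg δ {{ℚ.nonNegative (ℚ.<⇒≤ 0<δ)}}
           (subst (ℚ._≤ B) (ℚ.0≤p⇒∣p∣≡p (0≤z n)) (bound n (ℕ.m⊔n≤o⇒m≤o M₁ M₂ M≤n)))) ⟩
    seq y n ℚ.* seq z n ℚ.+ δ ℚ.* B           ≡⟨ cong (seq y n ℚ.* seq z n ℚ.+_) δB≡ε ⟩
    seq y n ℚ.* seq z n ℚ.+ ε                 ∎
  where open ℚ.≤-Reasoning

-- Comparison with the binary logarithm

2^-cancel-≤ : ∀ {m n} → 2 ℕ.^ m ≤ 2 ℕ.^ n → m ≤ n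
2^-cancel-≤ {m} {n} 2^m≤2^n = ℕ.≮⇒≥ λ n<m → ℕ.<⇒≱ (ℕ.^-monoʳ-< 2 (s≤s (s≤s ℕ.z≤n)) n<m) 2^m≤2^n

log₂-nonNeg : ∀ a .{{_ : NonZero a}} n → 0ℚ ℚ.≤ seq (log₂ a) n
log₂-nonNeg a n = 0≤/ ⌊log₂ (a ℕ.^ suc n) ⌋ (suc n)

-- Raise to the i-th power, estimate a^i by the next power of 2 and compare exponents. Division by i
-- turns this into an approximation of m ≤ n log₂ a with error at most n / i.
2^m≤a^n⇒m*i≤n*[1+⌊log₂a^i⌋] : ∀ a m n i → 2 ℕ.^ m ≤ a ℕ.^ n →
                               m ℕ.* i ≤ n ℕ.* suc ⌊log₂ (a ℕ.^ i) ⌋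
2^m≤a^n⇒m*i≤n*[1+⌊log₂a^i⌋] a m n i 2^m≤a^n = 2^-cancel-≤ (begin
  2 ℕ.^ (m ℕ.* i)      ≡⟨ ℕ.^-*-assoc 2 m i ⟨
  (2 ℕ.^ m) ℕ.^ i      ≤⟨ ℕ.^-monoˡ-≤ i 2^m≤a^n ⟩
  (a ℕ.^ n) ℕ.^ i      ≡⟨ ℕ.^-*-assoc a n i ⟩
  a ℕ.^ (n ℕ.* i)      ≡⟨ cong (a ℕ.^_) (ℕ.*-comm n i) ⟩
  a ℕ.^ (i ℕ.* n)      ≡⟨ ℕ.^-*-assoc a i n ⟨
  (a ℕ.^ i) ℕ.^ n      ≤⟨ ℕ.^-monoˡ-≤ n (ℕ.<⇒≤ (n<2^[1+⌊log₂n⌋] (a ℕ.^ i))) ⟩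
  (2 ℕ.^ suc l) ℕ.^ n  ≡⟨ ℕ.^-*-assoc 2 (suc l) n ⟩
  2 ℕ.^ (suc l ℕ.* n)  ≡⟨ cong (2 ℕ.^_) (ℕ.*-comm (suc l) n) ⟩
  2 ℕ.^ (n ℕ.* suc l)  ∎)
  where
  open ℕ.≤-Reasoning
  l = ⌊log₂ (a ℕ.^ i) ⌋

2^m≤a^n⇒m≤n*log₂a : ∀ a .{{_ : NonZero a}} m n → 2 ℕ.^ m ≤ a ℕ.^ n → fromℕ m ≤ᴿ fromℕ n *ᴿ log₂ a
2^m≤a^n⇒m≤n*log₂a a m n 2^m≤a^n ε 0<ε =
  -- Dividing by `suc n` keeps the divisor positive when n = 0; the error n / (i + 1) is then below
  -- ε for large i.
  let δ , 0<δ , δ*≡ε = quotient ε (+ suc n / 1) 0<ε (/-mono-< 0 1 (suc n) 1 (s≤s ℕ.z≤n))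
      M , small = archimedean δ 0<δ
  in M , λ i M≤i → begin
    + m / 1                                        ≤⟨ /-mono-≤ m 1 (n ℕ.* suc (L i)) (suc i) (bound i) ⟩
    + (n ℕ.* suc (L i)) / suc i
      ≡⟨ cong (λ l → + l / suc i) (trans (ℕ.*-suc n (L i)) (ℕ.+-comm n _)) ⟩
    + (n ℕ.* L i ℕ.+ n) / suc i                    ≡⟨ /-distribʳ-+ (n ℕ.* L i) n (suc i) ⟩
    (+ (n ℕ.* L i) / suc i) ℚ.+ (+ n / suc i)      ≡⟨ cong₂ ℚ._+_ (/-scale n (L i) (suc i)) (n/ (suc i)) ⟨
    n*l i ℚ.+ (+ n / 1) ℚ.* (+ 1 / suc i)
      ≤⟨ ℚ.+-monoʳ-≤ (n*l i) (ℚ.*-monoˡ-≤-nonNeg (+ n / 1) {{ℚ.normalize-nonNeg n 1}} (ℚ.<⇒≤ (small i M≤i))) ⟩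
    n*l i ℚ.+ (+ n / 1) ℚ.* δ
      ≤⟨ ℚ.+-monoʳ-≤ (n*l i) (ℚ.*-monoʳ-≤-nonNeg δ {{ℚ.nonNegative (ℚ.<⇒≤ 0<δ)}}
           (/-mono-≤ n 1 (suc n) 1 (ℕ.*-monoˡ-≤ 1 (ℕ.n≤1+n n)))) ⟩
    n*l i ℚ.+ (+ suc n / 1) ℚ.* δ                  ≡⟨ cong (n*l i ℚ.+_) (trans (ℚ.*-comm (+ suc n / 1) δ) δ*≡ε) ⟩
    n*l i ℚ.+ ε                                    ∎
  where
  open ℚ.≤-Reasoning
  L : ℕ → ℕ
  L i = ⌊log₂ (a ℕ.^ suc i) ⌋
  n*l : ℕ → ℚ
  n*l i = (+ n / 1) ℚ.* seq (log₂ a) i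
  n/ : ∀ d .{{_ : NonZero d}} → (+ n / 1) ℚ.* (+ 1 / d) ≡ + n / d
  n/ d = trans (/-scale n 1 d) (cong (λ k → + k / d) (ℕ.*-identityʳ n))
  bound : ∀ i → m ℕ.* suc i ≤ n ℕ.* suc (L i) ℕ.* 1
  bound i = ℕ.≤-trans (2^m≤a^n⇒m*i≤n*[1+⌊log₂a^i⌋] a m n (suc i) 2^m≤a^n)
    (ℕ.≤-reflexive (sym (ℕ.*-identityʳ _)))

-- Exponential against polynomial growth

1+n≤2^n : ∀ n → suc n ≤ 2 ℕ.^ n
1+n≤2^n zero    = ℕ.≤-refl
1+n≤2^n (suc n) = begin
  suc (suc n)              ≤⟨ s≤s (s≤s (ℕ.m≤n+m n n)) ⟩
  suc (suc (n ℕ.+ n))      ≡⟨ cong suc (ℕ.+-suc n n) ⟨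
  suc n ℕ.+ suc n          ≡⟨ cong (suc n ℕ.+_) (ℕ.+-identityʳ (suc n)) ⟨
  2 ℕ.* suc n              ≤⟨ ℕ.*-monoʳ-≤ 2 (1+n≤2^n n) ⟩
  2 ℕ.^ suc n              ∎
  where open ℕ.≤-Reasoning

-- With q = ⌊m / 2d⌋ one has C m < 2dC (q + 1) ≤ (q + 1)² ≤ 2^(2q) as soon as q ≥ 2dC.
polynomial<exponential : ∀ C d .{{_ : NonZero d}} →
                         ∃ λ m₀ → ∀ m → m₀ ≤ m → (C ℕ.* m) ℕ.^ d < 2 ℕ.^ m
-- With e = 2d, the threshold C e² guarantees q ≥ C e.
polynomial<exponential C d = C ℕ.* e ℕ.* e , λ m m₀≤m →
  let q = m ℕ./ e in begin-strict
  (C ℕ.* m) ℕ.^ d               <⟨ ℕ.^-monoˡ-< d (linear m m₀≤m) ⟩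
  ((2 ℕ.^ q) ℕ.^ 2) ℕ.^ d       ≡⟨ ℕ.^-*-assoc (2 ℕ.^ q) 2 d ⟩
  (2 ℕ.^ q) ℕ.^ e               ≡⟨ ℕ.^-*-assoc 2 q e ⟩
  2 ℕ.^ (q ℕ.* e)               ≤⟨ ℕ.^-monoʳ-≤ 2 (m/n*n≤m m e) ⟩
  2 ℕ.^ m                       ∎
  where
  open ℕ.≤-Reasoning
  e = 2 ℕ.* d
  instance
    e≢0 : NonZero e
    e≢0 = ℕ.m*n≢0 2 d
  linear : ∀ m → C ℕ.* e ℕ.* e ≤ m → C ℕ.* m < (2 ℕ.^ (m ℕ./ e)) ℕ.^ 2
  linear m m₀≤m = begin-strict
    C ℕ.* m                        ≤⟨ ℕ.*-monoʳ-≤ C (ℕ.<⇒≤ m<) ⟩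
    C ℕ.* (e ℕ.+ q ℕ.* e)          ≡⟨ cong (C ℕ.*_) (ℕ.*-comm (suc q) e) ⟩
    C ℕ.* (e ℕ.* suc q)            ≡⟨ ℕ.*-assoc C e (suc q) ⟨
    C ℕ.* e ℕ.* suc q              <⟨ ℕ.*-monoˡ-< (suc q) (s≤s Ce≤q) ⟩
    suc q ℕ.* suc q                ≤⟨ ℕ.*-mono-≤ (1+n≤2^n q) (1+n≤2^n q) ⟩
    2 ℕ.^ q ℕ.* 2 ℕ.^ q            ≡⟨ cong (2 ℕ.^ q ℕ.*_) (ℕ.*-identityʳ (2 ℕ.^ q)) ⟨
    (2 ℕ.^ q) ℕ.^ 2                ∎
    where
    q = m ℕ./ e
    Ce≤q : C ℕ.* e ≤ q
    Ce≤q = subst (_≤ q) (m*n/n≡m (C ℕ.* e) e) (/-monoˡ-≤ e m₀≤m)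
    m< : m < e ℕ.+ q ℕ.* e
    m< = ℕ.≤-trans (s≤s (ℕ.≤-reflexive (m≡m%n+[m/n]*n m e))) (ℕ.+-monoˡ-< (q ℕ.* e) (m%n<n m e))

eventual-≤ℕ : ∀ x → ∃ λ C → ∃ λ M → ∀ n → M ≤ n → seq x n ℚ.≤ + C / 1
eventual-≤ℕ x =
  let B , 0<B , M , bound = eventuallyBounded x
      C , B≤C = positive-≤ℕ B {{ℚ.positive 0<B}}
  in C , M , λ n M≤n → ℚ.≤-trans (p≤∣p∣ (seq x n)) (ℚ.≤-trans (bound n M≤n) B≤C)

-- C depends on x alone, so one bound serves all groups at once. The summand 1 is the tolerance at
-- which the real inequality is evaluated.
multipleBound : ∀ x → ∃ λ C → ∀ a b → fromℕ a ≤ᴿ x *ᴿ fromℕ b → a ≤ C ℕ.* b ℕ.+ 1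
multipleBound x = C , bound
  where
  open ℚ.≤-Reasoning
  C = proj₁ (eventual-≤ℕ x)
  M₁ = proj₁ (proj₂ (eventual-≤ℕ x))
  bound : ∀ a b → fromℕ a ≤ᴿ x *ᴿ fromℕ b → a ≤ C ℕ.* b ℕ.+ 1
  bound a b a≤xb =
    let M₂ , a≤ = a≤xb 1ℚ (ℚ.positive⁻¹ 1ℚ)
        n = M₁ ℕ.⊔ M₂
    in /1-cancel-≤ (begin
      + a / 1                              ≤⟨ a≤ n (ℕ.m≤n⊔m M₁ M₂) ⟩
      seq x n ℚ.* (+ b / 1) ℚ.+ 1ℚ
        ≤⟨ ℚ.+-monoˡ-≤ 1ℚ (ℚ.*-monoʳ-≤-nonNeg (+ b / 1) {{ℚ.normalize-nonNeg b 1}}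
             (proj₂ (proj₂ (eventual-≤ℕ x)) n (ℕ.m≤m⊔n M₁ M₂))) ⟩
      (+ C / 1) ℚ.* (+ b / 1) ℚ.+ 1ℚ       ≡⟨ cong (ℚ._+ 1ℚ) (/-scale C b 1) ⟩
      (+ (C ℕ.* b) / 1) ℚ.+ (+ 1 / 1)      ≡⟨ /-distribʳ-+ (C ℕ.* b) 1 1 ⟨
      + (C ℕ.* b ℕ.+ 1) / 1                ∎)

-- The difference of K₁ and k

1/P⁻ : FiniteAbelianGroup → ℚ
1/P⁻ G = (+ 1 / P⁻ (order G)) {{P⁻-nonZero (order G)}}

difference-bound : ∀ G → ∃ λ m → 2 ℕ.^ m ≤ order G × K₁ G - k G ℚ.≤ (+ m / 1) ℚ.* 1/P⁻ G
difference-bound G =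
  let m , 2^m≤∣G∣ , K₁≤ = K₁≤k+ (1/P⁻ G) λ g g≉0 →
        /-mono-≤ 1 (ord g) 1 (P⁻ (order G)) {{_}} {{P⁻-nonZero (order G)}}
          (ℕ.*-monoʳ-≤ 1 (P⁻≤divisor {{ord-nonTrivial g g≉0}} {{order-nonZero G}} (ord∣order g)))
  in m , 2^m≤∣G∣ , ℚ.≤-trans (ℚ.+-monoˡ-≤ (ℚ.- k G) K₁≤) (ℚ.≤-reflexive (cancel ((+ m / 1) ℚ.* 1/P⁻ G) (k G)))
  where
  open CrossNumbers G
  open ZeroSum G using (ord)
  cancel : ∀ p q → p ℚ.+ q - q ≡ p
  cancel = solve 2 (λ p q → p :+ q :- q := p) refl
    where open ℚSolver

proposition39 : (c N : ℝ) → 1ᴿ ≤ᴿ c → 1ᴿ ≤ᴿ N →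
    ((G : FiniteAbelianGroup) → NonTrivial (order G) → 𝒮 N G →
    fromℚ (K₁ G - k G) ≤ᴿ
    N *ᴿ (log₂ (P⁺ (order G)) {{P⁺-nonZero (order G)}}
    *ᴿ fromℚ ((+ 1 / P⁻ (order G)) {{P⁻-nonZero (order G)}})))
    ×
    ((ε : ℝ) → 0ᴿ <ᴿ ε →
    ∃ λ (P₀ : ℕ) → (G : FiniteAbelianGroup) → NonTrivial (order G) → Ω c G → 𝒮 N G →
    P₀ ≤ P⁻ (order G) → fromℚ ∣ K₁ G - k G ∣ <ᴿ ε)
proposition39 c N _ _ = upper , limit
  where
  upper : ∀ G → NonTrivial (order G) → 𝒮 N G → fromℚ (K₁ G - k G) ≤ᴿ
          N *ᴿ (log₂ (P⁺ (order G)) {{P⁺-nonZero (order G)}} *ᴿ fromℚ (1/P⁻ G))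
  upper G _ G∈𝒮 =
    let m , 2^m≤∣G∣ , K₁-k≤ = difference-bound G
        -- From 2^m ≤ |G| ≤ P⁺^n follows m ≤ n log₂ P⁺; then n ≤ N is inserted and the product
        -- reassociated.
        m≤n*l = 2^m≤a^n⇒m≤n*log₂a (P⁺ (order G)) m n (ℕ.≤-trans 2^m≤∣G∣ (order≤P⁺^ν G G∈𝒮))
    in ≤ᴿ-trans d (fromℕ m *ᴿ w) (N *ᴿ (l *ᴿ w))
         (pointwise⇒≤ᴿ d (fromℕ m *ᴿ w) λ _ → K₁-k≤)
      (≤ᴿ-trans (fromℕ m *ᴿ w) ((fromℕ n *ᴿ l) *ᴿ w) (N *ᴿ (l *ᴿ w))
         (*ᴿ-monoˡ-≤ᴿ (fromℕ m) (fromℕ n *ᴿ l) w 0≤w m≤n*l)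
      (≤ᴿ-trans ((fromℕ n *ᴿ l) *ᴿ w) ((N *ᴿ l) *ᴿ w) (N *ᴿ (l *ᴿ w))
         (*ᴿ-monoˡ-≤ᴿ (fromℕ n *ᴿ l) (N *ᴿ l) w 0≤w
           (*ᴿ-monoˡ-≤ᴿ (fromℕ n) N l (log₂-nonNeg (P⁺ (order G))) (𝒮.exponentSum≤N G∈𝒮)))
         (pointwise⇒≤ᴿ ((N *ᴿ l) *ᴿ w) (N *ᴿ (l *ᴿ w)) λ i →
           ℚ.≤-reflexive (ℚ.*-assoc (seq N i) (seq l i) (seq w i)))))
    where
    instance
      P⁺≢0 = P⁺-nonZero (order G)
    d = fromℚ (K₁ G - k G)
    n = ν G G∈𝒮
    l = log₂ (P⁺ (order G))
    w = fromℚ (1/P⁻ G)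
    0≤w : ∀ i → 0ℚ ℚ.≤ seq w i
    0≤w _ = 0≤/ 1 (P⁻ (order G)) {{P⁻-nonZero (order G)}}

  limit : (ε : ℝ) → 0ᴿ <ᴿ ε → ∃ λ P₀ → ∀ G → NonTrivial (order G) → Ω c G → 𝒮 N G →
          P₀ ≤ P⁻ (order G) → fromℚ ∣ K₁ G - k G ∣ <ᴿ ε
  -- P₀ = m₀ K is built from c, N and ε before any group is given.
  limit ε (η , 0<η , M , η≤ε) = m₀ ℕ.* K , λ G _ G∈Ω G∈𝒮 P₀≤P →
    δ , 0<δ , M , λ n M≤n → begin
      ∣ K₁ G - k G ∣ ℚ.+ δ   ≤⟨ ℚ.+-monoˡ-≤ δ (small G G∈Ω G∈𝒮 P₀≤P) ⟩
      δ ℚ.+ δ                ≡⟨ double δ ⟩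
      δ ℚ.* (+ 2 / 1)        ≡⟨ δ*2≡η ⟩
      η                      ≡⟨ ℚ.+-identityˡ η ⟨
      0ℚ ℚ.+ η               ≤⟨ η≤ε n M≤n ⟩
      seq ε n                ∎
    where
    open ℚ.≤-Reasoning
    double : ∀ p → p ℚ.+ p ≡ p ℚ.* (+ 2 / 1)
    double = solve 1 (λ p → p :+ p := p :* con (+ 2 / 1)) refl
      where open ℚSolver
    -- One half of η bounds the difference, the other is the gap demanded by `<ᴿ`.
    half = quotient η (+ 2 / 1) 0<η (ℚ.positive⁻¹ (+ 2 / 1))
    δ = proj₁ half
    0<δ = proj₁ (proj₂ half)
    δ*2≡η = proj₂ (proj₂ half)
    K = suc (proj₁ (archimedean δ 0<δ))
    1/K≤δ : + 1 / K ℚ.≤ δ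
    1/K≤δ = ℚ.<⇒≤ (proj₂ (archimedean δ 0<δ) (proj₁ (archimedean δ 0<δ)) ℕ.≤-refl)
    -- The successor absorbs the additive 1 of `multipleBound`, because P ≥ 1.
    C = suc (proj₁ (multipleBound c))
    -- The bound on ν, obtained with b = 1; its final summand also makes d positive.
    d = proj₁ (multipleBound N) ℕ.* 1 ℕ.+ 1
    instance
      d≢0 : NonZero d
      d≢0 = ℕ.>-nonZero (ℕ.m≤n+m 1 (proj₁ (multipleBound N) ℕ.* 1))
    growth = polynomial<exponential (C ℕ.* K) d
    m₀ = proj₁ growth

    module _ (G : FiniteAbelianGroup) (G∈Ω : Ω c G) (G∈𝒮 : 𝒮 N G) (P₀≤P : m₀ ℕ.* K ≤ P⁻ (order G)) where

      P = P⁻ (order G)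
      instance
        P≢0 = P⁻-nonZero (order G)
        P⁺≢0 = P⁺-nonZero (order G)
      m = proj₁ (difference-bound G)

      P⁺≤CP : P⁺ (order G) ≤ C ℕ.* P
      P⁺≤CP = ℕ.≤-trans (proj₂ (multipleBound c) (P⁺ (order G)) P G∈Ω)
        (ℕ.≤-trans (ℕ.+-monoʳ-≤ _ (ℕ.>-nonZero⁻¹ P)) (ℕ.≤-reflexive (ℕ.+-comm _ P)))

      ν≤d : ν G G∈𝒮 ≤ d
      ν≤d = proj₂ (multipleBound N) (ν G G∈𝒮) 1
        (≤ᴿ-trans (fromℕ (ν G G∈𝒮)) N (N *ᴿ fromℕ 1) (𝒮.exponentSum≤N G∈𝒮)
          (pointwise⇒≤ᴿ N (N *ᴿ fromℕ 1) λ i → ℚ.≤-reflexive (sym (ℚ.*-identityʳ (seq N i)))))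

      2^m≤[CP]^d : 2 ℕ.^ m ≤ (C ℕ.* P) ℕ.^ d
      2^m≤[CP]^d = ℕ.≤-trans (proj₁ (proj₂ (difference-bound G)))
        (ℕ.≤-trans (order≤P⁺^ν G G∈𝒮)
        (ℕ.≤-trans (ℕ.^-monoʳ-≤ (P⁺ (order G)) ν≤d) (ℕ.^-monoˡ-≤ d P⁺≤CP)))

      mK≤P : m ℕ.* K ≤ P
      -- If P < m K, then m₀ K ≤ P gives m₀ < m, so (C K m)^d < 2^m. But 2^m ≤ (C P)^d ≤ (C K m)^d,
      -- a contradiction.
      mK≤P = ℕ.≮⇒≥ λ P<mK → ℕ.<⇒≱
        (proj₂ growth m (ℕ.<⇒≤ (ℕ.*-cancelʳ-< K m₀ m (ℕ.≤-<-trans P₀≤P P<mK))))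
        (ℕ.≤-trans 2^m≤[CP]^d (ℕ.^-monoˡ-≤ d (ℕ.≤-trans (ℕ.*-monoʳ-≤ C (ℕ.<⇒≤ P<mK))
          (ℕ.≤-reflexive (trans (cong (C ℕ.*_) (ℕ.*-comm m K)) (sym (ℕ.*-assoc C K m)))))))

      small : ∣ K₁ G - k G ∣ ℚ.≤ δ
      small = begin
        ∣ K₁ G - k G ∣             ≡⟨ ℚ.0≤p⇒∣p∣≡p 0≤K₁-k ⟩
        K₁ G - k G                 ≤⟨ proj₂ (proj₂ (difference-bound G)) ⟩
        (+ m / 1) ℚ.* (+ 1 / P)    ≡⟨ /-scale m 1 P ⟩
        + (m ℕ.* 1) / P            ≡⟨ cong (λ n → + n / P) (ℕ.*-identityʳ m) ⟩
        + m / P                    ≤⟨ /-mono-≤ m P 1 K (ℕ.≤-trans mK≤P (ℕ.≤-reflexive (sym (ℕ.*-identityˡ P)))) ⟩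
        + 1 / K                    ≤⟨ 1/K≤δ ⟩
        δ                          ∎
        where
        0≤K₁-k : 0ℚ ℚ.≤ K₁ G - k G
        -- The lower bound k(G) ≤ K₁(G) removes the absolute value.
        0≤K₁-k = subst (ℚ._≤ K₁ G - k G) (ℚ.+-inverseʳ (k G))
          (ℚ.+-monoˡ-≤ (ℚ.- k G) (CrossNumbers.k≤K₁ G))
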